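{- For every symmetric Boolean function $f$ on $n$ inputs and every depth $d \ge 8$ with $d \equiv 2 \pmod 6$, there exists an $\mathsf{AC}^0[42]$ circuit of depth $d$ and size $\exp(\tilde{O}(n^{6/(13(d-2))}))$ computing $f$.
   Context: A Boolean function is symmetric if its value depends only on the number of ones in the input. An $\mathsf{AC}^0[42]$ circuit has unbounded fan-in AND, OR, NOT and $\text{MOD}_{42}$ gates (equivalently, up to wire multiplicities, $\text{MOD}_{m'}$ gates for divisors $m'$ of $42$), where a $\text{MOD}_{m}$ gate outputs $1$ iff the sum of its inputs is divisible by $m$. Size is the number of gates. $\tilde{O}(\cdot)$ hides polylogarithmic factors in $n$; constants may depend on $d$, with $n\to\infty$. -}

module Defs where

open import Data.Nat using (ℕ; zero; suc; _+_; _⊔_; _%_; _≡ᵇ_)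
open import Data.Bool using (Bool; true; false; not; _∧_; _∨_; if_then_else_)
open import Data.Fin using (Fin)
open import Data.Sum using (_⊎_; inj₁; inj₂)
open import Data.List using (List; []; _∷_)
open import Data.Vec using (Vec; []; _∷_; lookup)
open import Relation.Binary.PropositionalEquality using (_≡_)

ones : ∀ {n} → Vec Bool n → ℕ
ones [] = 0
ones (true ∷ xs) = suc (ones xs)
ones (false ∷ xs) = ones xs

Symmetric : ∀ {n} → (Vec Bool n → Bool) → Set
Symmetric {n} f = ∀ (x y : Vec Bool n) → ones x ≡ ones y → f x ≡ f y

-- A wire into a gate of a circuit on n inputs that already has k gates:
-- either an input variable or one of the k previously built gates.
Wire : ℕ → ℕ → Set
Wire n k = Fin n ⊎ Fin k

-- AC0[42] gates: unbounded fan-in AND, OR, MOD_42 (wires are a list, so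
-- repeated wires = wire multiplicities), and NOT (fan-in 1).
data Gate (n k : ℕ) : Set where
  AND   : List (Wire n k) → Gate n k
  OR    : List (Wire n k) → Gate n k
  NOT   : Wire n k → Gate n k
  MOD42 : List (Wire n k) → Gate n k

-- A circuit (DAG) with n inputs and k gates, listed newest first: each gate
-- may read inputs and any gate built before it.  The head gate is the output.
-- Size = number of gates = k.
data Circuit (n : ℕ) : ℕ → Set where
  []  : Circuit n 0
  _∷_ : ∀ {k} → Gate n k → Circuit n k → Circuit n (suc k)

wireVal : ∀ {n k} → Vec Bool n → Vec Bool k → Wire n k → Bool
wireVal x v (inj₁ i) = lookup x i
wireVal x v (inj₂ j) = lookup v j

countTrue : ∀ {n k} → Vec Bool n → Vec Bool k → List (Wire n k) → ℕ
countTrue x v [] = 0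
countTrue x v (w ∷ ws) = (if wireVal x v w then 1 else 0) + countTrue x v ws

allW : ∀ {n k} → Vec Bool n → Vec Bool k → List (Wire n k) → Bool
allW x v [] = true
allW x v (w ∷ ws) = wireVal x v w ∧ allW x v ws

anyW : ∀ {n k} → Vec Bool n → Vec Bool k → List (Wire n k) → Bool
anyW x v [] = false
anyW x v (w ∷ ws) = wireVal x v w ∨ anyW x v ws

gateVal : ∀ {n k} → Vec Bool n → Vec Bool k → Gate n k → Bool
gateVal x v (AND ws) = allW x v ws
gateVal x v (OR ws) = anyW x v ws
gateVal x v (NOT w) = not (wireVal x v w)
gateVal x v (MOD42 ws) = (countTrue x v ws % 42) ≡ᵇ 0

values : ∀ {n k} → Circuit n k → Vec Bool n → Vec Bool k
values [] x = []
values (g ∷ c) x = gateVal x (values c x) g ∷ values c x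

output : ∀ {n k} → Circuit n (suc k) → Vec Bool n → Bool
output (g ∷ c) x = gateVal x (values c x) g

wireDepth : ∀ {n k} → Vec ℕ k → Wire n k → ℕ
wireDepth ds (inj₁ i) = 0
wireDepth ds (inj₂ j) = lookup ds j

maxDepth : ∀ {n k} → Vec ℕ k → List (Wire n k) → ℕ
maxDepth ds [] = 0
maxDepth ds (w ∷ ws) = wireDepth ds w ⊔ maxDepth ds ws

gateDepth : ∀ {n k} → Vec ℕ k → Gate n k → ℕ
gateDepth ds (AND ws) = suc (maxDepth ds ws)
gateDepth ds (OR ws) = suc (maxDepth ds ws)
gateDepth ds (NOT w) = suc (wireDepth ds w)
gateDepth ds (MOD42 ws) = suc (maxDepth ds ws)

depths : ∀ {n k} → Circuit n k → Vec ℕ k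
depths [] = []
depths (g ∷ c) = gateDepth (depths c) g ∷ depths c

depth : ∀ {n k} → Circuit n (suc k) → ℕ
depth (g ∷ c) = gateDepth (depths c) g

Computes : ∀ {n k} → Circuit n (suc k) → (Vec Bool n → Bool) → Set
Computes c f = ∀ x → output c x ≡ f x

{-# OPTIONS --safe #-}
module Submission where

-- Write d = 2 + 6j.  Formulas of depth d and fan-in 2^Õ(b) with b^(13j) ≈ n are enough.
--
-- Exact counting modulo m³ᵗ: with p ∈ {2, 3, 7} and m ≈ b a power of p, a count c is determined
-- modulo mᵗ by the residues modulo p of the binomials (c choose D), D < mᵗ.  Such a binomial counts
-- the marked D-subsets of a list; cutting a subset into at most m segments at breakpoints in the list
-- makes it a sum, over the breakpoints and over the values in 𝔽ₚ of the segments, of products of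
-- the same quantities for D < mᵗ⁻¹, which is a MOD gate of AND gates.  So t levels cost 2t layers,
-- and the three primes together reach m³ᵗ by the Chinese remainder theorem.
--
-- Approximate counting: in a block of length L, sampling at the 2ᵏ points of a random cube
-- b + {0, a₁} + ⋯ + {0, aₖ} of ℤ/L has the variance of independent sampling.  By Lautemann's covering
-- argument the estimate is certified as ∃ translates ∀ seed ∃ translate, and the count of a sample is
-- itself computed exactly modulo b^(9j−3), which exceeds the sample size.
--
-- The output gate guesses, for each of b blocks of length b^(13j−1), its count and its translates.
-- Underneath, 6j layers give the block counts modulo b^(9j), and the samples confine each block count
-- to a range shorter than this modulus.

open import Defs
open import Data.Bool using (Bool; true; false; not; _∧_; _∨_; if_then_else_; T)
open import Data.Bool.ListAction using (and; or)
open import Data.Bool.Properties using (T?; T-≡; ∧-identityʳ; not-involutive)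
open import Data.Fin using (Fin; zero; suc)
open import Data.List using (List; []; _∷_; _++_; map; length; concat; concatMap; replicate; upTo; filter; cartesianProduct)
open import Data.List.Membership.Propositional using (_∈_; find; lose)
open import Data.List.Membership.Propositional.Properties using (∈-map⁺; ∈-upTo⁺; ∈-upTo⁻; ∈-concatMap⁺; ∈-filter⁺; ∈-filter⁻; ∈-cartesianProduct⁺; ∈-cartesianProduct⁻)
open import Data.List.Properties using (map-cong; map-∘; map-++; map-upTo; upTo-∷ʳ; length-map; length-++; length-replicate; length-upTo; length-filter)
open import Data.List.Relation.Unary.All as All using (All; []; _∷_)
import Data.List.Relation.Unary.All.Properties as All
open import Data.List.Relation.Unary.Any as Any using (Any; here; there)
import Data.List.Relation.Unary.Any.Properties as Any
open import Data.Nat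
open import Data.Nat.Combinatorics using (nC1≡n; nCk+nC[k+1]≡[n+1]C[k+1]) renaming (_C_ to _choose_)
open import Data.Nat.Coprimality as Coprime using (Coprime; coprime?; coprime-divisor)
open import Data.Nat.DivMod using ([m+n]%n≡m%n; [m+kn]%n≡m%n; m%n%n≡m%n; m*n%n≡0; n%n≡0; m%n<n; m<n⇒m%n≡m; m≡m%n+[m/n]*n; m%n*o≡m*o%[n*o]; m<n*o⇒m/o<n; %-congˡ; %-distribˡ-+; %-distribˡ-*)
open import Data.Nat.Divisibility using (_∣_; divides; divides-refl; _∣0; 1∣_; ∣1⇒≡1; ∣m+n∣m⇒∣n; ∣-trans; m∣m*n; m%n≡0⇒n∣m; *-monoˡ-∣; >⇒∤)
open import Data.Nat.Logarithm using (⌊log₂_⌋; ⌈log₂_⌉; ⌊log₂⌋-mono-≤; ⌈log₂⌉-mono-≤; ⌊log₂[2^n]⌋≡n; ⌈log₂2^n⌉≡n)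
open import Data.Nat.Primality using (Prime; prime?; euclidsLemma; prime⇒nonTrivial)
open import Data.Nat.Properties
open import Data.Nat.Tactic.RingSolver using (solve-∀)
open import Data.Product using (Σ; ∃; _×_; _,_; proj₁; proj₂)
open import Data.Sum using (_⊎_; inj₁; inj₂; [_,_]′)
open import Data.Vec using (Vec; []; _∷_; lookup; zipWith; toList)
open import Data.Vec.Properties using (length-toList)
open import Function using (_∘_; id; it; Equivalence)
open import Relation.Binary.Definitions using (tri<; tri≈; tri>)
open import Relation.Binary.PropositionalEquality
open import Relation.Nullary using (¬_; contradiction; yes; no)
open import Relation.Nullary.Decidable using (from-yes)

-- Formulas

-- The constant 13 is 9 + 4. Exact counting in all 6j layers reaches the modulus b^(9j). A sample of
-- size s estimates the count of a block of length L up to about L/√s, but its own count has only 6j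
-- - 2 layers, since the choice of a translate and the conjunction of checks below it take two; so s
-- must stay below b^(9j-3). With s about b^(8j-2), whose exponent meets this bound exactly at j =
-- 1, the error is L/b^(4j-1), which is b^(9j) for L = b^(13j-1).
--
-- The obstacle is to remove randomness in a fixed number of layers. Independent sampling points
-- would give L^s seeds, too many for a conjunction; a cube has L^(k+1), which is quasipolynomial.
-- Chebyshev's inequality leaves a failure probability 1/K, and no amplification follows: r
-- translates cover once 2^r exceeds the number of seeds, and soundness asks only for r < K, so K is
-- polylogarithmic. The outer ∃ and ∀ merge with the OR over guesses and the AND over tests, so only
-- the inner ∃ costs layers.

data Connective : Set where
  conj disj mod42 : Connective

-- Trees without sharing are affordable because the depth is constant: unfolding multiplies the
-- logarithm of the size by a constant at most.
data Formula (n : ℕ) : Set where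
  var  : Fin n → Formula n
  node : Connective → List (Formula n) → Formula n

bit : Bool → ℕ
bit b = if b then 1 else 0

trues : List Bool → ℕ
trues []       = 0
trues (b ∷ bs) = bit b + trues bs

apply : Connective → List Bool → Bool
apply conj  = and
apply disj  = or
apply mod42 bs = trues bs % 42 ≡ᵇ 0

module _ {n : ℕ} where

  eval  : Formula n → Vec Bool n → Bool
  evals : List (Formula n) → Vec Bool n → List Bool
  eval (var i)     x = lookup x i
  eval (node κ φs) x = apply κ (evals φs x)
  evals []       x = []
  evals (φ ∷ φs) x = eval φ x ∷ evals φs x

  height  : Formula n → ℕ
  heights : List (Formula n) → ℕ
  height (var i)     = 0
  height (node κ φs) = suc (heights φs)
  heights []       = 0
  heights (φ ∷ φs) = height φ ⊔ heights φs

  -- `after φ k` is the number of gates once φ has been compiled on top of k gates.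
  after  : Formula n → ℕ → ℕ
  afters : List (Formula n) → ℕ → ℕ
  after (var i)     k = k
  after (node κ φs) k = suc (afters φs k)
  afters []       k = k
  afters (φ ∷ φs) k = after φ (afters φs k)

  weaken  : ∀ φ {k} → Fin k → Fin (after φ k)
  weakens : ∀ φs {k} → Fin k → Fin (afters φs k)
  weaken (var i)     j = j
  weaken (node κ φs) j = suc (weakens φs j)
  weakens []       j = j
  weakens (φ ∷ φs) j = weaken φ (weakens φs j)

  weakenWire : ∀ φ {k} → Wire n k → Wire n (after φ k)
  weakenWire φ (inj₁ i) = inj₁ i
  weakenWire φ (inj₂ j) = inj₂ (weaken φ j)

  gate : ∀ {k} → Connective → List (Wire n k) → Gate n k
  gate conj  = AND
  gate disj  = OR
  gate mod42 = MOD42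

  wire : ∀ φ k → Wire n (after φ k)
  wire (var i)     k = inj₁ i
  wire (node κ φs) k = inj₂ zero

  wires : ∀ φs k → List (Wire n (afters φs k))
  wires []       k = []
  wires (φ ∷ φs) k = wire φ (afters φs k) ∷ map (weakenWire φ) (wires φs k)

  compile  : ∀ φ {k} → Circuit n k → Circuit n (after φ k)
  compiles : ∀ φs {k} → Circuit n k → Circuit n (afters φs k)
  compile (var i)         c = c
  compile (node κ φs) {k} c = gate κ (wires φs k) ∷ compiles φs c
  compiles []       c = c
  compiles (φ ∷ φs) c = compile φ (compiles φs c)

  gateVal-gate : ∀ κ x {k} (v : Vec Bool k) ws →
                 gateVal x v (gate κ ws) ≡ apply κ (map (wireVal x v) ws)
  gateVal-gate conj x v []       = refl
  gateVal-gate conj x v (w ∷ ws) = cong (wireVal x v w ∧_) (gateVal-gate conj x v ws)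
  gateVal-gate disj x v []       = refl
  gateVal-gate disj x v (w ∷ ws) = cong (wireVal x v w ∨_) (gateVal-gate disj x v ws)
  gateVal-gate mod42 x v ws      = cong (λ s → s % 42 ≡ᵇ 0) (countTrue-trues ws)
    where
    countTrue-trues : ∀ ws → countTrue x v ws ≡ trues (map (wireVal x v) ws)
    countTrue-trues []       = refl
    countTrue-trues (w ∷ ws) = cong (bit (wireVal x v w) +_) (countTrue-trues ws)

  gateDepth-gate : ∀ κ {k} (ds : Vec ℕ k) ws → gateDepth ds (gate κ ws) ≡ suc (maxDepth ds ws)
  gateDepth-gate conj  ds ws = refl
  gateDepth-gate disj  ds ws = refl
  gateDepth-gate mod42 ds ws = refl

  values-weaken  : ∀ φ {k} (c : Circuit n k) x j →
                   lookup (values (compile φ c) x) (weaken φ j) ≡ lookup (values c x) j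
  values-weakens : ∀ φs {k} (c : Circuit n k) x j →
                   lookup (values (compiles φs c) x) (weakens φs j) ≡ lookup (values c x) j
  values-weaken (var i)     c x j = refl
  values-weaken (node κ φs) c x j = values-weakens φs c x j
  values-weakens []       c x j = refl
  values-weakens (φ ∷ φs) c x j =
    trans (values-weaken φ (compiles φs c) x (weakens φs j)) (values-weakens φs c x j)

  depths-weaken  : ∀ φ {k} (c : Circuit n k) j →
                   lookup (depths (compile φ c)) (weaken φ j) ≡ lookup (depths c) j
  depths-weakens : ∀ φs {k} (c : Circuit n k) j →
                   lookup (depths (compiles φs c)) (weakens φs j) ≡ lookup (depths c) j
  depths-weaken (var i)     c j = refl
  depths-weaken (node κ φs) c j = depths-weakens φs c j
  depths-weakens []       c j = refl
  depths-weakens (φ ∷ φs) c j =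
    trans (depths-weaken φ (compiles φs c) (weakens φs j)) (depths-weakens φs c j)

  wireVal-weaken : ∀ φ {k} (c : Circuit n k) x w →
                   wireVal x (values (compile φ c) x) (weakenWire φ w) ≡ wireVal x (values c x) w
  wireVal-weaken φ c x (inj₁ i) = refl
  wireVal-weaken φ c x (inj₂ j) = values-weaken φ c x j

  maxDepth-weaken : ∀ φ {k} (c : Circuit n k) ws →
                    maxDepth (depths (compile φ c)) (map (weakenWire φ) ws) ≡ maxDepth (depths c) ws
  maxDepth-weaken φ c []            = refl
  maxDepth-weaken φ c (inj₁ i ∷ ws) = maxDepth-weaken φ c ws
  maxDepth-weaken φ c (inj₂ j ∷ ws) = cong₂ _⊔_ (depths-weaken φ c j) (maxDepth-weaken φ c ws)

  wireVal-wire  : ∀ φ {k} (c : Circuit n k) x →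
                  wireVal x (values (compile φ c) x) (wire φ k) ≡ eval φ x
  wireVal-wires : ∀ φs {k} (c : Circuit n k) x →
                  map (wireVal x (values (compiles φs c) x)) (wires φs k) ≡ evals φs x
  wireVal-wire (var i)     c x = refl
  wireVal-wire (node κ φs) c x =
    trans (gateVal-gate κ x (values (compiles φs c) x) (wires φs _)) (cong (apply κ) (wireVal-wires φs c x))
  wireVal-wires []           c x = refl
  wireVal-wires (φ ∷ φs) {k} c x = cong₂ _∷_ (wireVal-wire φ (compiles φs c) x)
    (trans (sym (map-∘ (wires φs k)))
      (trans (map-cong (wireVal-weaken φ (compiles φs c) x) (wires φs k)) (wireVal-wires φs c x)))

  wireDepth-wire : ∀ φ {k} (c : Circuit n k) → wireDepth (depths (compile φ c)) (wire φ k) ≡ height φ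
  maxDepth-wires : ∀ φs {k} (c : Circuit n k) → maxDepth (depths (compiles φs c)) (wires φs k) ≡ heights φs
  wireDepth-wire (var i)     c = refl
  wireDepth-wire (node κ φs) c =
    trans (gateDepth-gate κ (depths (compiles φs c)) (wires φs _)) (cong suc (maxDepth-wires φs c))
  maxDepth-wires []           c = refl
  maxDepth-wires (φ ∷ φs) {k} c = cong₂ _⊔_ (wireDepth-wire φ (compiles φs c))
    (trans (maxDepth-weaken φ (compiles φs c) (wires φs k)) (maxDepth-wires φs c))

  data Bounded (W : ℕ) : ℕ → Formula n → Set where
    var  : ∀ {h i} → Bounded W h (var i)
    node : ∀ {h κ φs} → length φs ≤ W → All (Bounded W h) φs → Bounded W (suc h) (node κ φs)

  height≤  : ∀ {W h φ} → Bounded W h φ → height φ ≤ h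
  heights≤ : ∀ {W h φs} → All (Bounded W h) φs → heights φs ≤ h
  height≤ var        = z≤n
  height≤ (node _ b) = s≤s (heights≤ b)
  heights≤ []       = z≤n
  heights≤ (b ∷ bs) = ⊔-lub (height≤ b) (heights≤ bs)

  -- The base `suc W` pays for the gate itself: 1 + W (W + 1)^h is at most (W + 1)^(h + 1).
  after≤  : ∀ {W h φ} → Bounded W h φ → ∀ k → after φ k ≤ suc W ^ h + k
  afters≤ : ∀ {W h φs} → All (Bounded W h) φs → ∀ k → afters φs k ≤ length φs * suc W ^ h + k
  after≤ var k = m≤n+m k _
  after≤ {W} {suc h} (node {φs = φs} l b) k = begin
    suc (afters φs k)                          ≤⟨ s≤s (afters≤ b k) ⟩
    suc (length φs * suc W ^ h + k)            ≤⟨ s≤s (+-monoˡ-≤ k (*-monoˡ-≤ (suc W ^ h) l)) ⟩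
    1 + (W * suc W ^ h + k)                    ≤⟨ +-monoˡ-≤ (W * suc W ^ h + k) (m^n>0 (suc W) h) ⟩
    suc W ^ h + (W * suc W ^ h + k)            ≡⟨ sym (+-assoc (suc W ^ h) _ k) ⟩
    suc W ^ suc h + k                          ∎
    where open ≤-Reasoning
  afters≤ [] k = ≤-refl
  afters≤ {W} {h} {φ ∷ φs} (b ∷ bs) k = begin
    after φ (afters φs k)                            ≤⟨ after≤ b (afters φs k) ⟩
    suc W ^ h + afters φs k                          ≤⟨ +-monoʳ-≤ (suc W ^ h) (afters≤ bs k) ⟩
    suc W ^ h + (length φs * suc W ^ h + k)          ≡⟨ sym (+-assoc (suc W ^ h) _ k) ⟩
    length (φ ∷ φs) * suc W ^ h + k                  ∎
    where open ≤-Reasoning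

  -- A bare variable compiles to no gate at all; positive height guarantees an output gate.
  toCircuit : ∀ φ {h} → height φ ≡ suc h →
    Σ ℕ λ s → Σ (Circuit n (suc s)) λ c →
      Computes c (eval φ) × depth c ≡ suc h × suc s ≡ after φ 0
  toCircuit φ@(node κ φs) eq =
    afters φs 0 , compile φ [] , wireVal-wire φ [] , trans (wireDepth-wire φ []) eq , refl

  -- Fan-in 1 conjunctions at the output make the depth exact.
  pad : ℕ → Formula n → Formula n
  pad zero    φ = φ
  pad (suc e) φ = node conj (pad e φ ∷ [])

  eval-pad : ∀ e φ x → eval (pad e φ) x ≡ eval φ x
  eval-pad zero    φ x = refl
  eval-pad (suc e) φ x = trans (∧-identityʳ _) (eval-pad e φ x)

  height-pad : ∀ e φ → height (pad e φ) ≡ e + height φ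
  height-pad zero    φ = refl
  height-pad (suc e) φ = cong suc (trans (⊔-identityʳ _) (height-pad e φ))

  after-pad : ∀ e φ → after (pad e φ) 0 ≡ e + after φ 0
  after-pad zero    φ = refl
  after-pad (suc e) φ = cong suc (after-pad e φ)

  bounded⇒circuit : ∀ {W h φ} → Bounded W (suc h) φ →
    Σ ℕ λ s → Σ (Circuit n (suc s)) λ c →
      Computes c (eval φ) × depth c ≡ suc h × suc s ≤ suc h + suc W ^ suc h
  bounded⇒circuit {W} {h} {φ} b = s , c , (λ x → trans (computes x) (eval-pad e φ x)) , depth≡ , size≤
    where
    e = suc h ∸ height φ
    open Σ (toCircuit (pad e φ) (trans (height-pad e φ) (m∸n+n≡m (height≤ b)))) renaming (proj₁ to s; proj₂ to r)
    open Σ r renaming (proj₁ to c; proj₂ to r′)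
    computes = proj₁ r′
    depth≡   = proj₁ (proj₂ r′)
    size≤ : suc s ≤ suc h + suc W ^ suc h
    size≤ = begin
      suc s                      ≡⟨ proj₂ (proj₂ r′) ⟩
      after (pad e φ) 0          ≡⟨ after-pad e φ ⟩
      e + after φ 0              ≤⟨ +-mono-≤ (m∸n≤m (suc h) (height φ)) (after≤ b 0) ⟩
      suc h + (suc W ^ suc h + 0) ≡⟨ cong (suc h +_) (+-identityʳ _) ⟩
      suc h + suc W ^ suc h      ∎
      where open ≤-Reasoning

-- Finite sums

private variable
  A B : Set

∑ : List A → (A → ℕ) → ℕ
∑ []       f = 0
∑ (a ∷ as) f = f a + ∑ as f

∑-cong : ∀ (as : List A) {f g : A → ℕ} → (∀ a → f a ≡ g a) → ∑ as f ≡ ∑ as g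
∑-cong []       eq = refl
∑-cong (a ∷ as) eq = cong₂ _+_ (eq a) (∑-cong as eq)

∑-mono : ∀ (as : List A) {f g : A → ℕ} → (∀ a → f a ≤ g a) → ∑ as f ≤ ∑ as g
∑-mono []       le = z≤n
∑-mono (a ∷ as) le = +-mono-≤ (le a) (∑-mono as le)

∑-++ : ∀ (as bs : List A) (f : A → ℕ) → ∑ (as ++ bs) f ≡ ∑ as f + ∑ bs f
∑-++ []       bs f = refl
∑-++ (a ∷ as) bs f = trans (cong (f a +_) (∑-++ as bs f)) (sym (+-assoc (f a) _ _))

∑-map : ∀ (g : A → B) as (f : B → ℕ) → ∑ (map g as) f ≡ ∑ as (f ∘ g)
∑-map g []       f = refl
∑-map g (a ∷ as) f = cong (f (g a) +_) (∑-map g as f)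

∑-concatMap : ∀ (g : A → List B) as (f : B → ℕ) → ∑ (concatMap g as) f ≡ ∑ as (λ a → ∑ (g a) f)
∑-concatMap g []       f = refl
∑-concatMap g (a ∷ as) f =
  trans (∑-++ (g a) (concatMap g as) f) (cong (∑ (g a) f +_) (∑-concatMap g as f))

∑-replicate : ∀ n (a : A) (f : A → ℕ) → ∑ (replicate n a) f ≡ n * f a
∑-replicate zero    a f = refl
∑-replicate (suc n) a f = cong (f a +_) (∑-replicate n a f)

∑-zero : ∀ (as : List A) → ∑ as (λ _ → 0) ≡ 0
∑-zero []       = refl
∑-zero (a ∷ as) = ∑-zero as

∑-+ : ∀ (as : List A) (f g : A → ℕ) → ∑ as (λ a → f a + g a) ≡ ∑ as f + ∑ as g
∑-+ []       f g = refl
∑-+ (a ∷ as) f g = trans (cong (f a + g a +_) (∑-+ as f g)) (interchange (f a) (g a) (∑ as f) (∑ as g))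
  where
  interchange : ∀ a b c d → a + b + (c + d) ≡ a + c + (b + d)
  interchange = solve-∀

∑-*ˡ : ∀ (as : List A) c (f : A → ℕ) → ∑ as (λ a → c * f a) ≡ c * ∑ as f
∑-*ˡ []       c f = sym (*-zeroʳ c)
∑-*ˡ (a ∷ as) c f = trans (cong (c * f a +_) (∑-*ˡ as c f)) (sym (*-distribˡ-+ c (f a) _))

∑-*ʳ : ∀ (as : List A) c (f : A → ℕ) → ∑ as (λ a → f a * c) ≡ ∑ as f * c
∑-*ʳ as c f = trans (∑-cong as (λ a → *-comm (f a) c)) (trans (∑-*ˡ as c f) (*-comm c _))

∑-const : ∀ (as : List A) c → ∑ as (λ _ → c) ≡ length as * c
∑-const []       c = refl
∑-const (a ∷ as) c = cong (c +_) (∑-const as c)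

∑-comm : ∀ (as : List A) (bs : List B) (f : A → B → ℕ) →
         ∑ as (λ a → ∑ bs (f a)) ≡ ∑ bs (λ b → ∑ as (λ a → f a b))
∑-comm []       bs f = sym (∑-zero bs)
∑-comm (a ∷ as) bs f =
  trans (cong (∑ bs (f a) +_) (∑-comm as bs f)) (sym (∑-+ bs (f a) (λ b → ∑ as (λ a → f a b))))

∑-upTo-suc : ∀ n (f : ℕ → ℕ) → ∑ (upTo (suc n)) f ≡ f 0 + ∑ (upTo n) (f ∘ suc)
∑-upTo-suc n f = cong (f 0 +_)
  (trans (cong (λ is → ∑ is f) (sym (map-upTo suc n))) (∑-map suc (upTo n) f))

length-concatMap≤ : ∀ {m} (f : A → List B) {as} → All (λ a → length (f a) ≤ m) as →
                    length (concatMap f as) ≤ length as * m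
length-concatMap≤ f []                 = z≤n
length-concatMap≤ f {a ∷ as} (l ∷ ls) =
  ≤-trans (≤-reflexive (length-++ (f a))) (+-mono-≤ l (length-concatMap≤ f ls))

bit-∧ : ∀ a b → bit (a ∧ b) ≡ bit a * bit b
bit-∧ true  b = sym (+-identityʳ (bit b))
bit-∧ false b = refl

-- Boolean functions together with formulas that compute them

Fn : ℕ → Set
Fn n = Vec Bool n → Bool

infixl 9 _at_
_at_ : ∀ {n} → List (Fn n) → Vec Bool n → List Bool
gs at x = map (λ g → g x) gs

-- The height is an upper bound, so that a variable may stand next to deep formulas under one gate.
record Comp {n} (W h : ℕ) (g : Fn n) : Set where
  constructor comp
  field
    formula  : Formula n
    computes : ∀ x → eval formula x ≡ g x
    bounded  : Bounded W h formula

module _ {n W : ℕ} where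

  comp-cong : ∀ {h} {g g′ : Fn n} → (∀ x → g x ≡ g′ x) → Comp W h g → Comp W h g′
  comp-cong eq (comp φ e b) = comp φ (λ x → trans (e x) (eq x)) b

  comp-var : ∀ {h} i → Comp W h (λ (x : Vec Bool n) → lookup x i)
  comp-var i = comp (var i) (λ x → refl) var

  comp-node : ∀ {h} κ {gs : List (Fn n)} → length gs ≤ W → All (Comp W h) gs →
              Comp W (suc h) (λ x → apply κ (gs at x))
  comp-node κ {gs} l cs = comp (node κ (formulas cs)) (λ x → cong (apply κ) (evals-formulas cs x))
    (node (subst (_≤ W) (length-formulas cs) l) (bounded-formulas cs))
    where
    formulas : ∀ {h gs} → All (Comp W h) gs → List (Formula n)
    formulas []       = []
    formulas (c ∷ cs) = Comp.formula c ∷ formulas cs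
    evals-formulas : ∀ {h gs} (cs : All (Comp W h) gs) x → evals (formulas cs) x ≡ gs at x
    evals-formulas []       x = refl
    evals-formulas (c ∷ cs) x = cong₂ _∷_ (Comp.computes c x) (evals-formulas cs x)
    length-formulas : ∀ {h gs} (cs : All (Comp W h) gs) → length gs ≡ length (formulas cs)
    length-formulas []       = refl
    length-formulas (c ∷ cs) = cong suc (length-formulas cs)
    bounded-formulas : ∀ {h gs} (cs : All (Comp W h) gs) → All (Bounded W h) (formulas cs)
    bounded-formulas []       = []
    bounded-formulas (c ∷ cs) = Comp.bounded c ∷ bounded-formulas cs

  trues-at : ∀ (gs : List (Fn n)) x → trues (gs at x) ≡ ∑ gs (λ g → bit (g x))
  trues-at []       x = refl
  trues-at (g ∷ gs) x = cong (bit (g x) +_) (trues-at gs x)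

  -- A MOD_p gate for p ∣ 42 is a MOD_42 gate with every wire repeated 42 / p times.
  comp-mod : ∀ {h} p q .{{_ : NonZero p}} .{{_ : NonZero q}} → p * q ≡ 42 →
             {gs : List (Fn n)} → q * length gs ≤ W → All (Comp W h) gs →
             Comp W (suc h) (λ x → ∑ gs (λ g → bit (g x)) % p ≡ᵇ 0)
  comp-mod p q pq {gs} l cs =
    comp-cong (λ x → trans (cong (λ s → s % 42 ≡ᵇ 0) (repeated x)) (scale (∑ gs (λ g → bit (g x)))))
      (comp-node mod42 len (All.concat⁺ (All.replicate⁺ q cs)))
    where
    length-copies : ∀ q → length (concat (replicate q gs)) ≡ q * length gs
    length-copies zero    = refl
    length-copies (suc q) = trans (length-++ gs) (cong (length gs +_) (length-copies q))
    len : length (concat (replicate q gs)) ≤ W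
    len = subst (_≤ W) (sym (length-copies q)) l
    ∑-copies : ∀ q f → ∑ (concat (replicate q gs)) f ≡ q * ∑ gs f
    ∑-copies zero    f = refl
    ∑-copies (suc q) f = trans (∑-++ gs _ f) (cong (∑ gs f +_) (∑-copies q f))
    repeated : ∀ x → trues (concat (replicate q gs) at x) ≡ q * ∑ gs (λ g → bit (g x))
    repeated x = trans (trues-at (concat (replicate q gs)) x) (∑-copies q _)
    *-≡ᵇ0 : ∀ q r .{{_ : NonZero q}} → (r * q ≡ᵇ 0) ≡ (r ≡ᵇ 0)
    *-≡ᵇ0 (suc q) zero    = refl
    *-≡ᵇ0 (suc q) (suc r) = refl
    scale-% : ∀ {m} .{{_ : NonZero m}} s → p * q ≡ m → q * s % m ≡ s % p * q
    scale-% {m} s refl = trans (%-congˡ {o = m} (*-comm q s)) (sym (m%n*o≡m*o%[n*o] s p q))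
    scale : ∀ s → (q * s % 42 ≡ᵇ 0) ≡ (s % p ≡ᵇ 0)
    scale s = trans (cong (_≡ᵇ 0) (scale-% s pq)) (*-≡ᵇ0 q (s % p))

≡ᵇ-refl : ∀ n → (n ≡ᵇ n) ≡ true
≡ᵇ-refl zero    = refl
≡ᵇ-refl (suc n) = ≡ᵇ-refl n

≡ᵇ-true⁻ : ∀ m n → (m ≡ᵇ n) ≡ true → m ≡ n
≡ᵇ-true⁻ m n eq = ≡ᵇ⇒≡ m n (subst T (sym eq) _)

≢⇒≡ᵇ-false : ∀ m n → m ≢ n → (m ≡ᵇ n) ≡ false
≢⇒≡ᵇ-false m n m≢n with m ≡ᵇ n in eq
... | true  = contradiction (≡ᵇ-true⁻ m n eq) m≢n
... | false = refl

-- Cutting a subset of a list at a breakpoint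

splits : List A → List (List A × A × List A)
splits []       = []
splits (a ∷ as) = ([] , a , as) ∷ map (λ (l , b , r) → a ∷ l , b , r) (splits as)

length-splits : ∀ (as : List A) → length (splits as) ≡ length as
length-splits []       = refl
length-splits (a ∷ as) = cong suc (trans (length-map _ (splits as)) (length-splits as))

splits-shorter : ∀ (as : List A) →
                 All (λ (l , b , r) → length l ≤ length as × length r ≤ length as) (splits as)
splits-shorter []       = []
splits-shorter (a ∷ as) = (z≤n , n≤1+n _) ∷
  All.map⁺ (All.map (λ (l≤ , r≤) → s≤s l≤ , m≤n⇒m≤1+n r≤) (splits-shorter as))

-- A (B + 1 + D)-subset of the marked elements is cut at its (B + 1)-st element.
splits-C : ∀ (w : A → Bool) as B D →
  ∑ (splits as) (λ (l , a , r) → bit (w a) * ((∑ l (bit ∘ w) choose B) * (∑ r (bit ∘ w) choose D)))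
    ≡ ∑ as (bit ∘ w) choose (suc B + D)
splits-C w []       B D = refl
splits-C w (a ∷ as) B D =
  trans (cong (bit (w a) * ((0 choose B) * (c choose D)) +_) (∑-map _ (splits as) _)) (cut (w a) B)
  where
  c = ∑ as (bit ∘ w)
  cut : ∀ v B → bit v * ((0 choose B) * (c choose D)) +
                ∑ (splits as) (λ (l , a , r) → bit (w a) * (((bit v + ∑ l (bit ∘ w)) choose B) * (∑ r (bit ∘ w) choose D)))
                ≡ (bit v + c) choose (suc B + D)
  cut false B       = splits-C w as B D
  cut true  zero    = trans (cong₂ _+_ (trans (*-identityˡ _) (*-identityˡ _)) (splits-C w as 0 D))
                            (nCk+nC[k+1]≡[n+1]C[k+1] c D)
  cut true  (suc B) = begin
    ∑ (splits as) (λ (l , a , r) → bit (w a) * ((suc (∑ l (bit ∘ w)) choose suc B) * (∑ r (bit ∘ w) choose D)))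
      ≡⟨ ∑-cong (splits as) (λ (l , a , r) → pascal (bit (w a)) (∑ l (bit ∘ w)) (∑ r (bit ∘ w) choose D)) ⟩
    ∑ (splits as) (λ (l , a , r) →
        bit (w a) * ((∑ l (bit ∘ w) choose B) * (∑ r (bit ∘ w) choose D)) +
        bit (w a) * ((∑ l (bit ∘ w) choose suc B) * (∑ r (bit ∘ w) choose D)))
      ≡⟨ ∑-+ (splits as) _ _ ⟩
    _ ≡⟨ cong₂ _+_ (splits-C w as B D) (splits-C w as (suc B) D) ⟩
    c choose (suc B + D) + c choose (suc (suc B) + D)
      ≡⟨ nCk+nC[k+1]≡[n+1]C[k+1] c (suc B + D) ⟩
    suc c choose (suc (suc B) + D) ∎
    where
    open ≡-Reasoning
    distrib : ∀ b u v s → b * ((u + v) * s) ≡ b * (u * s) + b * (v * s)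
    distrib = solve-∀
    pascal : ∀ b u s → b * ((suc u choose suc B) * s) ≡ b * ((u choose B) * s) + b * ((u choose suc B) * s)
    pascal b u s = trans (cong (λ v → b * (v * s)) (sym (nCk+nC[k+1]≡[n+1]C[k+1] u B)))
                         (distrib b (u choose B) (u choose suc B) s)

-- Congruences and residue tests modulo p

module _ (p : ℕ) .{{_ : NonZero p}} where

  +-%-cong : ∀ {a a′ b b′} → a % p ≡ a′ % p → b % p ≡ b′ % p → (a + b) % p ≡ (a′ + b′) % p
  +-%-cong {a} {a′} {b} {b′} eq eq′ =
    trans (%-distribˡ-+ a b p) (trans (cong₂ (λ u v → (u + v) % p) eq eq′) (sym (%-distribˡ-+ a′ b′ p)))

  *-%-cong : ∀ {a a′ b b′} → a % p ≡ a′ % p → b % p ≡ b′ % p → (a * b) % p ≡ (a′ * b′) % p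
  *-%-cong {a} {a′} {b} {b′} eq eq′ =
    trans (%-distribˡ-* a b p) (trans (cong₂ (λ u v → (u * v) % p) eq eq′) (sym (%-distribˡ-* a′ b′ p)))

  -- A MOD gate tests only for 0. Adding p - r makes it test for r, because s + (p - r) lies
  -- strictly between 0 and 2p, where p is the only multiple of p.
  shifted-≡ᵇ : ∀ s r → s < p → r < p → ((s + (p ∸ r)) % p ≡ᵇ 0) ≡ (s ≡ᵇ r)
  shifted-≡ᵇ s r s<p r<p with <-cmp s r
  ... | tri≈ _ refl _ = trans
    (cong (_≡ᵇ 0) (trans (cong (_% p) (m+[n∸m]≡n (<⇒≤ s<p))) (n%n≡0 p))) (sym (≡ᵇ-refl s))
  ... | tri< s<r s≢r _ = trans
    (≢⇒≡ᵇ-false _ 0 (λ eq → <⇒≢ (<-≤-trans (m<n⇒0<n∸m r<p) (m≤n+m (p ∸ r) s)) (sym (trans (sym (m<n⇒m%n≡m small)) eq))))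
    (sym (≢⇒≡ᵇ-false s r s≢r))
    where
    small : s + (p ∸ r) < p
    small = <-≤-trans (+-monoˡ-< (p ∸ r) s<r) (≤-reflexive (m+[n∸m]≡n (<⇒≤ r<p)))
  ... | tri> _ s≢r r<s = trans
    (≢⇒≡ᵇ-false _ 0 (λ eq → <⇒≢ (m<n⇒0<n∸m r<s) (sym (trans (sym (m<n⇒m%n≡m {n = p} {m = s ∸ r} (≤-<-trans (m∸n≤m s r) s<p))) (trans (sym wrap) eq)))))
    (sym (≢⇒≡ᵇ-false s r s≢r))
    where
    wrap : (s + (p ∸ r)) % p ≡ (s ∸ r) % p
    wrap = trans (cong (_% p) (begin
      s + (p ∸ r)       ≡⟨ cong (_+ (p ∸ r)) (sym (m∸n+n≡m (<⇒≤ r<s))) ⟩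
      s ∸ r + r + (p ∸ r) ≡⟨ +-assoc (s ∸ r) r (p ∸ r) ⟩
      s ∸ r + (r + (p ∸ r)) ≡⟨ cong (s ∸ r +_) (m+[n∸m]≡n (<⇒≤ r<p)) ⟩
      s ∸ r + p         ∎)) ([m+n]%n≡m%n (s ∸ r) p)
      where open ≡-Reasoning

∑-upTo-select : ∀ n r (f : ℕ → ℕ) → r < n → ∑ (upTo n) (λ v → f v * bit (r ≡ᵇ v)) ≡ f r
∑-upTo-select (suc n) zero f _ = trans (∑-upTo-suc n _) (trans
  (cong₂ _+_ (*-identityʳ (f 0)) (trans (∑-cong (upTo n) (λ v → *-zeroʳ (f (suc v)))) (∑-zero (upTo n))))
  (+-identityʳ (f 0)))
∑-upTo-select (suc n) (suc r) f (s≤s r<n) = trans (∑-upTo-suc n _)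
  (trans (cong (_+ ∑ (upTo n) (λ v → f (suc v) * bit (r ≡ᵇ v))) (*-zeroʳ (f 0))) (∑-upTo-select n r (f ∘ suc) r<n))

residue : ∀ {n} p .{{_ : NonZero p}} → (Vec Bool n → ℕ) → ℕ → Fn n
residue p e r x = e x % p ≡ᵇ r

count : ∀ {n} → List (Fin n) → Vec Bool n → ℕ
count ℓ x = ∑ ℓ (λ i → bit (lookup x i))

product : ∀ {n} → List (Fn n) → Fn n
product gs x = and (gs at x)

-- Binomial coefficients of counts as sums of products modulo p

module Modular {n : ℕ} (W p q : ℕ) .{{_ : NonZero p}} .{{_ : NonZero q}} (p*q≡42 : p * q ≡ 42) where

  value : List (List (Fn n)) → Vec Bool n → ℕ
  value S x = ∑ S (λ gs → bit (product gs x))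

  -- A sum of products that agrees with e modulo p: `size` will be the number of AND gates under a
  -- MOD gate and `width` their fan-in.
  record Expansion (h size width : ℕ) (e : Vec Bool n → ℕ) : Set where
    constructor expansion
    field
      terms    : List (List (Fn n))
      value-≡  : ∀ x → value terms x % p ≡ e x % p
      few      : length terms ≤ size
      narrow   : All (λ gs → length gs ≤ width) terms
      factors  : All (All (Comp W h)) terms

  expand-cong : ∀ {h s w e e′} → (∀ x → e x ≡ e′ x) → Expansion h s w e → Expansion h s w e′
  expand-cong eq (expansion S v f nw c) = expansion S (λ x → trans (v x) (cong (_% p) (eq x))) f nw c

  expand-≤ : ∀ {h s s′ w w′ e} → s ≤ s′ → w ≤ w′ → Expansion h s w e → Expansion h s′ w′ e
  expand-≤ s≤ w≤ (expansion S v f nw c) =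
    expansion S v (≤-trans f s≤) (All.map (λ l → ≤-trans l w≤) nw) c

  expand-one : ∀ {h} → Expansion h 1 0 (λ _ → 1)
  expand-one = expansion ([] ∷ []) (λ x → refl) ≤-refl (z≤n ∷ []) ([] ∷ [])

  expand-var : ∀ {h} i → Expansion h 1 1 (λ x → bit (lookup x i))
  expand-var i = expansion (((λ x → lookup x i) ∷ []) ∷ [])
    (λ x → cong (_% p) (trans (+-identityʳ _) (cong bit (∧-identityʳ (lookup x i)))))
    ≤-refl (≤-refl ∷ []) ((comp-var i ∷ []) ∷ [])

  and-++ : ∀ as bs → and (as ++ bs) ≡ and as ∧ and bs
  and-++ []           bs = refl
  and-++ (true  ∷ as) bs = and-++ as bs
  and-++ (false ∷ as) bs = refl

  expand-* : ∀ {h s s′ w w′ e e′} → Expansion h s w e → Expansion h s′ w′ e′ →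
             Expansion h (s * s′) (w + w′) (λ x → e x * e′ x)
  expand-* {s′ = s′} {w} {w′} (expansion S v f nw c) (expansion S′ v′ f′ nw′ c′) = expansion
    (concatMap (λ gs → map (gs ++_) S′) S)
    (λ x → trans (cong (_% p) (value-* x)) (*-%-cong p (v x) (v′ x)))
    (≤-trans (length-concatMap≤ _ (All.universal (λ gs → ≤-trans (≤-reflexive (length-map (gs ++_) S′)) f′) S))
             (*-monoˡ-≤ s′ f))
    (All.concat⁺ (All.map⁺ (All.map (λ {gs} l → All.map⁺ (All.map (λ l′ →
       ≤-trans (≤-reflexive (length-++ gs)) (+-mono-≤ l l′)) nw′)) nw)))
    (All.concat⁺ (All.map⁺ (All.map (λ cs → All.map⁺ (All.map (All.++⁺ cs) c′)) c)))
    where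
    product-++ : ∀ gs gs′ x → bit (product (gs ++ gs′) x) ≡ bit (product gs x) * bit (product gs′ x)
    product-++ gs gs′ x = trans (cong (bit ∘ and) (map-++ (λ g → g x) gs gs′))
      (trans (cong bit (and-++ (gs at x) (gs′ at x))) (bit-∧ (product gs x) (product gs′ x)))
    value-* : ∀ x → value (concatMap (λ gs → map (gs ++_) S′) S) x ≡ value S x * value S′ x
    value-* x = trans (∑-concatMap _ S _) (trans
      (∑-cong S (λ gs → trans (∑-map (gs ++_) S′ _) (trans
        (∑-cong S′ (λ gs′ → product-++ gs gs′ x)) (∑-*ˡ S′ (bit (product gs x)) _))))
      (∑-*ʳ S (value S′ x) _))

  expand-∑ : ∀ {h s w} {as : List A} (e : A → Vec Bool n → ℕ) →
             All (λ a → Expansion h s w (e a)) as →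
             Expansion h (length as * s) w (λ x → ∑ as (λ a → e a x))
  expand-∑ e [] = expansion [] (λ x → refl) z≤n [] []
  expand-∑ e (expansion S v f nw c ∷ Es) with expand-∑ e Es
  ... | expansion S′ v′ f′ nw′ c′ = expansion (S ++ S′)
    (λ x → trans (cong (_% p) (∑-++ S S′ _)) (+-%-cong p (v x) (v′ x)))
    (≤-trans (≤-reflexive (length-++ S)) (+-mono-≤ f f′)) (All.++⁺ nw nw′) (All.++⁺ c c′)

  -- Modulo p, e is the sum over r of r copies of the test for residue r. A residue computed at one
  -- level thus becomes a factor at the next without an extra layer.
  residues⇒expansion : ∀ {h} e → (∀ r → r < p → Comp W h (residue p e r)) → Expansion h (p * p) 1 e
  residues⇒expansion {h} e comps = expansion (concatMap terms (upTo p)) value≡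
    (≤-trans (length-concatMap≤ terms (All.map (λ {r} r<p → ≤-trans (≤-reflexive (length-replicate r)) (<⇒≤ r<p)) (All.all-upTo p)))
      (≤-reflexive (cong (_* p) (length-upTo p))))
    (All.concat⁺ (All.map⁺ (All.universal (λ r → All.replicate⁺ r ≤-refl) (upTo p))))
    (All.concat⁺ (All.map⁺ (All.map (λ {r} r<p → All.replicate⁺ r (comps r r<p ∷ [])) (All.all-upTo p))))
    where
    terms : ℕ → List (List (Fn n))
    terms r = replicate r (residue p e r ∷ [])
    value≡ : ∀ x → value (concatMap terms (upTo p)) x % p ≡ e x % p
    value≡ x = trans (cong (_% p) (begin
      value (concatMap terms (upTo p)) x        ≡⟨ ∑-concatMap terms (upTo p) _ ⟩
      ∑ (upTo p) (λ r → value (terms r) x)      ≡⟨ ∑-cong (upTo p) (λ r → trans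
          (∑-replicate r (residue p e r ∷ []) (λ gs → bit (product gs x)))
          (cong (λ b → r * bit b) (∧-identityʳ _))) ⟩
      ∑ (upTo p) (λ r → r * bit (e x % p ≡ᵇ r)) ≡⟨ ∑-upTo-select p (e x % p) id (m%n<n (e x) p) ⟩
      e x % p                                   ∎)) (m%n%n≡m%n (e x) p)
      where open ≡-Reasoning

  expansion⇒residue : ∀ {h s w e} → q * (s + p) ≤ W → w ≤ W → Expansion h s w e →
                      ∀ {r} → r < p → Comp W (suc (suc h)) (residue p e r)
  expansion⇒residue {h} {s} {w} {e} s≤ w≤ (expansion S v f nw c) {r} r<p =
    comp-cong correct (comp-mod p q p*q≡42 len
      (All.map⁺ (products (All.++⁺ nw (All.replicate⁺ (p ∸ r) z≤n)) (All.++⁺ c (All.replicate⁺ (p ∸ r) [])))))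
    where
    -- Empty products are constantly true, so these terms add the shift p - r of `shifted-≡ᵇ`.
    S′ = S ++ replicate (p ∸ r) []
    len : q * length (map product S′) ≤ W
    len = ≤-trans (*-monoʳ-≤ q (begin
      length (map product S′)              ≡⟨ length-map product S′ ⟩
      length S′                            ≡⟨ length-++ S ⟩
      length S + length (replicate (p ∸ r) []) ≡⟨ cong (length S +_) (length-replicate (p ∸ r)) ⟩
      length S + (p ∸ r)                   ≤⟨ +-mono-≤ f (m∸n≤m p r) ⟩
      s + p                                ∎)) s≤
      where open ≤-Reasoning
    products : ∀ {S} → All (λ gs → length gs ≤ w) S → All (All (Comp W h)) S →
               All (λ gs → Comp W (suc h) (product gs)) S
    products []       []       = []
    products (l ∷ ls) (c ∷ cs) = comp-node conj (≤-trans l w≤) c ∷ products ls cs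
    total : ∀ x → ∑ (map product S′) (λ g → bit (g x)) ≡ value S x + (p ∸ r)
    total x = trans (∑-map product S′ _) (trans (∑-++ S _ _)
      (cong (value S x +_) (trans (∑-replicate (p ∸ r) [] (λ gs → bit (product gs x))) (*-identityʳ (p ∸ r)))))
    correct : ∀ x → (∑ (map product S′) (λ g → bit (g x)) % p ≡ᵇ 0) ≡ residue p e r x
    correct x = trans (cong (λ t → t % p ≡ᵇ 0) (total x)) (trans
      (cong (_≡ᵇ 0) (+-%-cong p {value S x} {e x % p} {p ∸ r} (trans (v x) (sym (m%n%n≡m%n (e x) p))) refl))
      (shifted-≡ᵇ p (e x % p) r (m%n<n (e x) p) r<p))

  module _ (N : ℕ) where

    Expands : ℕ → ℕ → ℕ → ℕ → Set
    Expands h s w D = ∀ ℓ → length ℓ ≤ N → Expansion h s w (λ x → count ℓ x choose D)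

    -- Each of the k cuts uses up B chosen elements and the breakpoint itself, which makes k (B + 1)
    -- + ρ in all. A cut multiplies the number of terms by N for the breakpoint and by s for its
    -- segment, and adds two factors: the input at the breakpoint and the segment.
    expand-segments : ∀ {h s B ρ} → Expands h s 1 B → Expands h s 1 ρ →
                      ∀ k → Expands h ((N * s) ^ k * s) (k * 2 + 1) (k * suc B + ρ)
    expand-segments {h} {s} full rest zero ℓ l = expand-≤ (≤-reflexive (sym (*-identityˡ s))) ≤-refl (rest ℓ l)
    expand-segments {h} {s} {B} {ρ} full rest (suc k) ℓ l =
      expand-cong (λ x → trans (splits-C (lookup x) ℓ B (k * suc B + ρ))
                               (cong (count ℓ x choose_) (sym (+-assoc (suc B) (k * suc B) ρ))))
        (expand-≤ size≤ ≤-refl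
          (expand-∑ _ (All.map (λ { {l′ , i , r′} (l≤ , r≤) →
              expand-* (expand-var i) (expand-* (full l′ (≤-trans l≤ l))
                (expand-segments full rest k r′ (≤-trans r≤ l))) }) (splits-shorter ℓ))))
      where
      rearrange : ∀ N s t → N * (1 * (s * (t * s))) ≡ N * s * t * s
      rearrange = solve-∀
      size≤ : length (splits ℓ) * (1 * (s * ((N * s) ^ k * s))) ≤ (N * s) ^ suc k * s
      size≤ = ≤-trans (*-monoˡ-≤ _ (≤-trans (≤-reflexive (length-splits ℓ)) l))
                      (≤-reflexive (rearrange N s ((N * s) ^ k)))

    module _ (m : ℕ) .{{_ : NonZero m}}
             (size≤ : q * ((N * (p * p)) ^ m * (p * p) + p) ≤ W) (width≤ : m * 2 + 1 ≤ W)
             .{{_ : NonZero N}} where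

      expand-binomial  : ∀ t {D} → D < m ^ t → Expands (t * 2) (p * p) 1 D
      residue-binomial : ∀ t {D} → D < m ^ suc t → ∀ ℓ → length ℓ ≤ N → ∀ {r} → r < p →
                         Comp W (suc t * 2) (residue p (λ x → count ℓ x choose D) r)
      expand-binomial zero    {zero} D< ℓ l = expand-≤ (>-nonZero⁻¹ (p * p) {{m*n≢0 p p}}) z≤n expand-one
      expand-binomial zero    {suc D} (s≤s ()) ℓ l
      expand-binomial (suc t) D< ℓ l =
        residues⇒expansion _ (λ r → residue-binomial t D< ℓ l)
      residue-binomial t {D} D< ℓ l =
        expansion⇒residue
          (≤-trans (*-monoʳ-≤ q (+-monoˡ-≤ p (*-monoˡ-≤ (p * p) (^-monoʳ-≤ (N * (p * p)) (<⇒≤ k<m))))) size≤)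
          (≤-trans (+-monoˡ-≤ 1 (*-monoˡ-≤ 2 (<⇒≤ k<m))) width≤)
          (expand-cong (λ x → cong (count ℓ x choose_) digits)
            (expand-segments (expand-binomial t B<) (expand-binomial t (m%n<n D (m ^ t))) k ℓ l))
        where
        instance
          _ : NonZero (m ^ t)
          _ = m^n≢0 m t
          _ : NonZero (N * (p * p))
          _ = m*n≢0 N (p * p) {{it}} {{m*n≢0 p p}}
        -- The leading digit of D in base m is the number of cuts. With B = m^t - 1 a segment and
        -- its breakpoint account for m^t elements, and both B and the remainder of D are below m^t,
        -- as the recursion requires.
        k = D / m ^ t
        k<m : k < m
        k<m = m<n*o⇒m/o<n D<
        B< : pred (m ^ t) < m ^ t
        B< = ≤-reflexive (suc-pred (m ^ t))
        digits : k * suc (pred (m ^ t)) + D % m ^ t ≡ D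
        digits = trans (cong (λ u → k * u + D % m ^ t) (suc-pred (m ^ t)))
                       (trans (+-comm (k * m ^ t) _) (sym (m≡m%n+[m/n]*n D (m ^ t))))

-- Binomial coefficients modulo a prime determine residues modulo its powers

-- Adding a (p - 1) does the work of subtracting a, which ℕ lacks.
+-%-cancelˡ : ∀ p .{{_ : NonZero p}} {a a′ b b′} → a % p ≡ a′ % p → (a + b) % p ≡ (a′ + b′) % p →
              b % p ≡ b′ % p
+-%-cancelˡ p@(suc r) {a} {a′} {b} {b′} eq eq′ = begin
  b % p                ≡⟨ sym ([m+kn]%n≡m%n b a p) ⟩
  (b + a * p) % p      ≡⟨ cong (_% p) (rearrange a b r) ⟩
  (a + b + a * r) % p  ≡⟨ +-%-cong p {a + b} {a′ + b′} {a * r} {a′ * r} eq′ (*-%-cong p {a} {a′} {r} {r} eq refl) ⟩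
  (a′ + b′ + a′ * r) % p ≡⟨ cong (_% p) (sym (rearrange a′ b′ r)) ⟩
  (b′ + a′ * p) % p    ≡⟨ [m+kn]%n≡m%n b′ a′ p ⟩
  b′ % p               ∎
  where
  open ≡-Reasoning
  rearrange : ∀ a b r → b + a * suc r ≡ a + b + a * r
  rearrange = solve-∀

-- The absorption identity, free of division; it is applied with `suc k` a power of p.
C-absorb : ∀ n k → suc k * (suc n choose suc k) ≡ suc n * (n choose k)
C-absorb zero    zero    = refl
C-absorb zero    (suc k) = *-zeroʳ (suc (suc k))
C-absorb (suc n) zero    = trans (*-identityˡ _) (trans (nC1≡n (suc (suc n))) (sym (*-identityʳ _)))
C-absorb (suc n) (suc k) = begin
  suc (suc k) * (suc (suc n) choose suc (suc k))
    ≡⟨ cong (suc (suc k) *_) (sym (nCk+nC[k+1]≡[n+1]C[k+1] (suc n) (suc k))) ⟩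
  suc (suc k) * (S + suc n choose suc (suc k))
    ≡⟨ split k S (suc n choose suc (suc k)) ⟩
  S + (suc k * S + suc (suc k) * (suc n choose suc (suc k)))
    ≡⟨ cong (S +_) (cong₂ _+_ (C-absorb n k) (C-absorb n (suc k))) ⟩
  S + (suc n * (n choose k) + suc n * (n choose suc k))
    ≡⟨ cong (S +_) (sym (*-distribˡ-+ (suc n) (n choose k) (n choose suc k))) ⟩
  S + suc n * (n choose k + n choose suc k)
    ≡⟨ cong (λ t → S + suc n * t) (nCk+nC[k+1]≡[n+1]C[k+1] n k) ⟩
  suc (suc n) * S ∎
  where
  open ≡-Reasoning
  S = suc n choose suc k
  split : ∀ k s t → suc (suc k) * (s + t) ≡ s + (suc k * s + suc (suc k) * t)
  split = solve-∀

module _ {p : ℕ} .{{_ : NonZero p}} (p-prime : Prime p) where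

  private
    1<p : 1 < p
    1<p = nonTrivial⇒n>1 p {{prime⇒nonTrivial p-prime}}

  -- For w = suc v the Pascal relations force v choose j ≡ ± 1 for all j < p ^ a, so the
  -- absorption identity at D = p ^ e lifts divisibility from p ^ e to p ^ (e + 1).
  ∣C⇒^∣ : ∀ a w → (∀ D → suc D < p ^ a → p ∣ w choose suc D) → ∀ {e} → e ≤ a → p ^ e ∣ w
  ∣C⇒^∣ a zero    dvd _ = _ ∣0
  ∣C⇒^∣ a (suc v) dvd {zero}  _   = 1∣ suc v
  ∣C⇒^∣ a (suc v) dvd {suc e} e<a with ∣C⇒^∣ a (suc v) dvd (<⇒≤ e<a)
  ... | divides u eq = [ lifted , (λ p∣ → contradiction p∣ (nonzero (pred P) (≤-<-trans (pred[n]≤n {P}) P<))) ]′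
                         (euclidsLemma u (v choose pred P) p-prime (subst (p ∣_) quotient≡ (dvd (pred P) P-1<)))
    where
    P = p ^ e
    instance
      P≢0 : NonZero P
      P≢0 = m^n≢0 p e
    P< : P < p ^ a
    P< = ^-monoʳ-< p 1<p e<a
    P-1< : suc (pred P) < p ^ a
    P-1< = subst (_< p ^ a) (sym (suc-pred P)) P<
    nonzero : ∀ j → j < p ^ a → ¬ p ∣ v choose j
    nonzero zero    _  p∣1 = <⇒≢ 1<p (sym (∣1⇒≡1 p∣1))
    nonzero (suc j) j< p∣  = nonzero j (<-trans (n<1+n j) j<)
      (∣m+n∣m⇒∣n (subst (p ∣_) (trans (sym (nCk+nC[k+1]≡[n+1]C[k+1] v j)) (+-comm (v choose j) _)) (dvd j j<)) p∣)
    quotient≡ : suc v choose suc (pred P) ≡ u * (v choose pred P)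
    quotient≡ = *-cancelˡ-≡ _ _ P (begin
      P * (suc v choose suc (pred P))            ≡⟨ cong (_* (suc v choose suc (pred P))) (sym (suc-pred P)) ⟩
      suc (pred P) * (suc v choose suc (pred P)) ≡⟨ C-absorb v (pred P) ⟩
      suc v * (v choose pred P)                  ≡⟨ cong (_* (v choose pred P)) (trans eq (*-comm u P)) ⟩
      P * u * (v choose pred P)                  ≡⟨ *-assoc P u _ ⟩
      P * (u * (v choose pred P))                ∎)
      where open ≡-Reasoning
    lifted : p ∣ u → p * P ∣ suc v
    lifted p∣u = subst (p * P ∣_) (sym eq) (*-monoˡ-∣ P p∣u)

  -- By Pascal's rule, the congruences for `suc u` and `suc v` descend to u and v, recursively in D.
  -- This continues until one number is 0, whose binomials with D > 0 vanish; then `∣C⇒^∣` applies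
  -- to the other one.
  C-residues⇒^∣ : ∀ a u v → (∀ D → D < p ^ a → (u choose D) % p ≡ (v choose D) % p) → p ^ a ∣ ∣ u - v ∣
  C-residues⇒^∣ a zero    v       eq = ∣C⇒^∣ a v (λ D D< → m%n≡0⇒n∣m _ p (trans (sym (eq (suc D) D<)) (m*n%n≡0 0 p))) ≤-refl
  C-residues⇒^∣ a (suc u) zero    eq = ∣C⇒^∣ a (suc u) (λ D D< → m%n≡0⇒n∣m _ p (trans (eq (suc D) D<) (m*n%n≡0 0 p))) ≤-refl
  C-residues⇒^∣ a (suc u) (suc v) eq = C-residues⇒^∣ a u v peel
    where
    peel : ∀ D → D < p ^ a → (u choose D) % p ≡ (v choose D) % p
    peel zero    _  = refl
    peel (suc D) D< = +-%-cancelˡ p {u choose D} {v choose D} (peel D (<-trans (n<1+n D) D<))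
      (subst₂ (λ s t → s % p ≡ t % p) (sym (nCk+nC[k+1]≡[n+1]C[k+1] u D)) (sym (nCk+nC[k+1]≡[n+1]C[k+1] v D))
        (eq (suc D) D<))

-- Chinese remainder theorem for powers of 2, 3 and 7

coprime-* : ∀ {i j k} → Coprime i k → Coprime j k → Coprime (i * j) k
coprime-* {i} {j} ci cj {d} (d∣ij , d∣k) =
  cj (coprime-divisor {d} {i} {j} (λ (c∣d , c∣i) → ci (c∣i , ∣-trans c∣d d∣k)) d∣ij , d∣k)

coprime-^ˡ : ∀ {i k} → Coprime i k → ∀ a → Coprime (i ^ a) k
coprime-^ˡ c zero    = Coprime.1-coprimeTo _
coprime-^ˡ c (suc a) = coprime-* c (coprime-^ˡ c a)

coprime-^ : ∀ {i k} → Coprime i k → ∀ a b → Coprime (i ^ a) (k ^ b)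
coprime-^ c a b = coprime-^ˡ (Coprime.sym (coprime-^ˡ (Coprime.sym c) b)) a

coprime-∣-* : ∀ {i j w} → Coprime i j → i ∣ w → j ∣ w → i * j ∣ w
coprime-∣-* {i} {j} c (divides-refl u) j∣w
  with coprime-divisor (Coprime.sym c) (subst (j ∣_) (*-comm u i) j∣w)
... | divides-refl t = subst (i * j ∣_) (rearrange i j t) (m∣m*n t)
  where
  rearrange : ∀ i j t → i * j * t ≡ t * j * i
  rearrange = solve-∀

close⇒≡ : ∀ {Q u v} → Q ∣ ∣ u - v ∣ → ∣ u - v ∣ < Q → u ≡ v
close⇒≡ {Q} {u} {v} dvd lt with ∣ u - v ∣ in eq
... | zero  = ∣m-n∣≡0⇒m≡n eq
... | suc w = contradiction dvd (>⇒∤ lt)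

chinese-2-3-7 : ∀ {u v} a b c → 2 ^ a ∣ ∣ u - v ∣ → 3 ^ b ∣ ∣ u - v ∣ → 7 ^ c ∣ ∣ u - v ∣ →
                ∣ u - v ∣ < 2 ^ a * 3 ^ b * 7 ^ c → u ≡ v
chinese-2-3-7 a b c d₂ d₃ d₇ = close⇒≡
  (coprime-∣-* (coprime-* (coprime-^ (from-yes (coprime? 2 7)) a c) (coprime-^ (from-yes (coprime? 3 7)) b c))
    (coprime-∣-* (coprime-^ (from-yes (coprime? 2 3)) a b) d₂ d₃) d₇)

-- Enumerating vectors

∑-cong-∈ : ∀ (as : List A) {f g : A → ℕ} → (∀ {a} → a ∈ as → f a ≡ g a) → ∑ as f ≡ ∑ as g
∑-cong-∈ []       eq = refl
∑-cong-∈ (a ∷ as) eq = cong₂ _+_ (eq (here refl)) (∑-cong-∈ as (eq ∘ there))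

vecs : List A → ∀ k → List (Vec A k)
vecs as zero    = [] ∷ []
vecs as (suc k) = concatMap (λ a → map (a ∷_) (vecs as k)) as

∑-vecs-suc : ∀ (as : List A) k f → ∑ (vecs as (suc k)) f ≡ ∑ as (λ a → ∑ (vecs as k) (λ v → f (a ∷ v)))
∑-vecs-suc as k f = trans (∑-concatMap _ as f) (∑-cong as (λ a → ∑-map (a ∷_) (vecs as k) f))

∑-one : ∀ (as : List A) → ∑ as (λ _ → 1) ≡ length as
∑-one as = trans (∑-const as 1) (*-identityʳ (length as))

length-vecs : ∀ (as : List A) k → length (vecs as k) ≡ length as ^ k
length-vecs as zero    = refl
length-vecs as (suc k) = begin
  length (vecs as (suc k))                   ≡⟨ sym (∑-one (vecs as (suc k))) ⟩
  ∑ (vecs as (suc k)) (λ _ → 1)              ≡⟨ ∑-vecs-suc as k _ ⟩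
  ∑ as (λ _ → ∑ (vecs as k) (λ _ → 1))       ≡⟨ ∑-const as _ ⟩
  length as * ∑ (vecs as k) (λ _ → 1)        ≡⟨ cong (length as *_) (trans (∑-one (vecs as k)) (length-vecs as k)) ⟩
  length as ^ suc k                          ∎
  where open ≡-Reasoning

^-distribʳ-* : ∀ k m n → (m * n) ^ k ≡ m ^ k * n ^ k
^-distribʳ-* zero    m n = refl
^-distribʳ-* (suc k) m n = trans (cong (m * n *_) (^-distribʳ-* k m n)) (interchange m n (m ^ k) (n ^ k))
  where
  interchange : ∀ a b c d → a * b * (c * d) ≡ a * c * (b * d)
  interchange = solve-∀

-- Translations of the seed space (ℤ / L) ^ k

module _ (L : ℕ) .{{_ : NonZero L}} where

  ∑-upTo-last : ∀ n f → ∑ (upTo (suc n)) f ≡ ∑ (upTo n) f + f n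
  ∑-upTo-last n f = trans (cong (λ is → ∑ is f) (sym (upTo-∷ʳ n)))
    (trans (∑-++ (upTo n) (n ∷ []) f) (cong (∑ (upTo n) f +_) (+-identityʳ (f n))))

  -- Extend f periodically to ℕ: shifting the range by one trades the summand at 0 for the equal one
  -- at L.
  ∑-rotate : ∀ (f : ℕ → ℕ) b → ∑ (upTo L) (λ a → f ((b + a) % L)) ≡ ∑ (upTo L) f
  ∑-rotate f b = trans (periodic b (λ i → f (i % L)) (λ i → cong f ([m+n]%n≡m%n i L)))
                       (∑-cong-∈ (upTo L) (λ a∈ → cong f (m<n⇒m%n≡m (∈-upTo⁻ a∈))))
    where
    step : ∀ g → (∀ i → g (i + L) ≡ g i) → ∑ (upTo L) (g ∘ suc) ≡ ∑ (upTo L) g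
    step g per = +-cancelˡ-≡ (g 0) _ _ (trans (sym (∑-upTo-suc L g)) (trans (∑-upTo-last L g)
      (trans (cong (∑ (upTo L) g +_) (per 0)) (+-comm _ (g 0)))))
    periodic : ∀ b g → (∀ i → g (i + L) ≡ g i) → ∑ (upTo L) (λ a → g (b + a)) ≡ ∑ (upTo L) g
    periodic zero    g per = refl
    periodic (suc b) g per = trans (periodic b (g ∘ suc) (per ∘ suc)) (step g per)

  infixl 6 _⊕_
  _⊕_ : ∀ {k} → Vec ℕ k → Vec ℕ k → Vec ℕ k
  _⊕_ = zipWith (λ a b → (a + b) % L)

  ⊕-comm : ∀ {k} (u v : Vec ℕ k) → u ⊕ v ≡ v ⊕ u
  ⊕-comm []      []      = refl
  ⊕-comm (a ∷ u) (b ∷ v) = cong₂ _∷_ (cong (_% L) (+-comm a b)) (⊕-comm u v)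

  seeds : ∀ k → List (Vec ℕ k)
  seeds k = vecs (upTo L) k

  length-seeds : ∀ k → length (seeds k) ≡ L ^ k
  length-seeds k = trans (length-vecs (upTo L) k) (cong (_^ k) (length-upTo L))

  ∑-translate : ∀ {k} (u : Vec ℕ k) f → ∑ (seeds k) (λ s → f (u ⊕ s)) ≡ ∑ (seeds k) f
  ∑-translate []            f = refl
  ∑-translate {suc k} (b ∷ u) f = begin
    ∑ (seeds (suc k)) (λ s → f ((b ∷ u) ⊕ s))
      ≡⟨ ∑-vecs-suc (upTo L) k _ ⟩
    ∑ (upTo L) (λ a → ∑ (seeds k) (λ s → f ((b + a) % L ∷ u ⊕ s)))
      ≡⟨ ∑-cong (upTo L) (λ a → ∑-translate u (λ s → f ((b + a) % L ∷ s))) ⟩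
    ∑ (upTo L) (λ a → ∑ (seeds k) (λ s → f ((b + a) % L ∷ s)))
      ≡⟨ ∑-rotate (λ a → ∑ (seeds k) (λ s → f (a ∷ s))) b ⟩
    ∑ (upTo L) (λ a → ∑ (seeds k) (λ s → f (a ∷ s)))
      ≡⟨ sym (∑-vecs-suc (upTo L) k f) ⟩
    ∑ (seeds (suc k)) f ∎
    where open ≡-Reasoning

  -- Sampling at the points of a random cube b + {0 , a₁} + ⋯ + {0 , aₖ}

  points : ∀ {k} → Vec ℕ k → ℕ → List ℕ
  points []       b = b ∷ []
  points (a ∷ as) b = points as b ++ points as ((a + b) % L)

  length-points : ∀ {k} (as : Vec ℕ k) b → length (points as b) ≡ 2 ^ k
  length-points         []       b = refl
  length-points {suc k} (a ∷ as) b = trans (length-++ (points as b))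
    (trans (cong₂ _+_ (length-points as b) (length-points as _)) (cong (2 ^ k +_) (sym (+-identityʳ (2 ^ k)))))

  module _ (h : ℕ → ℕ) where

    hits : ∀ {k} → Vec ℕ k → ℕ → ℕ
    hits as b = ∑ (points as b) h

    total : ℕ
    total = ∑ (upTo L) h

    hits-∷ : ∀ {k} a (as : Vec ℕ k) b → hits (a ∷ as) b ≡ hits as b + hits as ((a + b) % L)
    hits-∷ a as b = ∑-++ (points as b) _ h

    ∑-hits : ∀ {k} (as : Vec ℕ k) → ∑ (upTo L) (hits as) ≡ 2 ^ k * total
    ∑-hits []               = trans (∑-cong (upTo L) (λ b → +-identityʳ (h b))) (sym (+-identityʳ total))
    ∑-hits {suc k} (a ∷ as) = begin
      ∑ (upTo L) (hits (a ∷ as))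
        ≡⟨ trans (∑-cong (upTo L) (hits-∷ a as)) (∑-+ (upTo L) _ _) ⟩
      ∑ (upTo L) (hits as) + ∑ (upTo L) (λ b → hits as ((a + b) % L))
        ≡⟨ cong (∑ (upTo L) (hits as) +_) (∑-rotate (hits as) a) ⟩
      ∑ (upTo L) (hits as) + ∑ (upTo L) (hits as)
        ≡⟨ cong₂ _+_ (∑-hits as) (∑-hits as) ⟩
      2 ^ k * total + 2 ^ k * total
        ≡⟨ double (2 ^ k) total ⟩
      2 ^ suc k * total ∎
      where
      open ≡-Reasoning
      double : ∀ m c → m * c + m * c ≡ 2 * m * c
      double = solve-∀

    moment : ℕ → ℕ
    moment k = ∑ (seeds k) (λ as → ∑ (upTo L) (λ b → hits as b * hits as b))

    -- Doubling the cube squares H(b) + H(a + b). The two squares have equal sums, and for fixed b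
    -- the point a + b is uniform in a, so the cross term factorises: the two halves are
    -- uncorrelated.
    moment-suc : ∀ k → moment (suc k) ≡ 2 * L * moment k + L ^ k * (2 * (2 ^ k * total * (2 ^ k * total)))
    moment-suc k = begin
      moment (suc k)
        ≡⟨ ∑-vecs-suc (upTo L) k _ ⟩
      ∑ (upTo L) (λ a → ∑ (seeds k) (λ as → ∑ (upTo L) (λ b → hits (a ∷ as) b * hits (a ∷ as) b)))
        ≡⟨ ∑-comm (upTo L) (seeds k) _ ⟩
      ∑ (seeds k) (λ as → ∑ (upTo L) (λ a → ∑ (upTo L) (λ b → hits (a ∷ as) b * hits (a ∷ as) b)))
        ≡⟨ ∑-cong (seeds k) square ⟩
      ∑ (seeds k) (λ as → 2 * L * ∑ (upTo L) (λ b → hits as b * hits as b) + 2 * (μ * μ))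
        ≡⟨ ∑-+ (seeds k) _ _ ⟩
      ∑ (seeds k) (λ as → 2 * L * ∑ (upTo L) (λ b → hits as b * hits as b)) + ∑ (seeds k) (λ _ → 2 * (μ * μ))
        ≡⟨ cong₂ _+_ (∑-*ˡ (seeds k) (2 * L) _) (trans (∑-const (seeds k) _) (cong (_* (2 * (μ * μ))) (length-seeds k))) ⟩
      2 * L * moment k + L ^ k * (2 * (μ * μ)) ∎
      where
      open ≡-Reasoning
      μ = 2 ^ k * total
      expand : ∀ u v → (u + v) * (u + v) ≡ u * u + v * v + 2 * (u * v)
      expand = solve-∀
      square : ∀ as → ∑ (upTo L) (λ a → ∑ (upTo L) (λ b → hits (a ∷ as) b * hits (a ∷ as) b))
                      ≡ 2 * L * ∑ (upTo L) (λ b → hits as b * hits as b) + 2 * (μ * μ)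
      square as = begin
        ∑ (upTo L) (λ a → ∑ (upTo L) (λ b → hits (a ∷ as) b * hits (a ∷ as) b))
          ≡⟨ ∑-cong (upTo L) (λ a → trans
               (∑-cong (upTo L) (λ b → trans (cong (λ t → t * t) (hits-∷ a as b)) (expand (H b) (H ((a + b) % L)))))
               (trans (∑-+ (upTo L) _ _) (cong₂ _+_ (trans (∑-+ (upTo L) _ _)
                 (cong (E +_) (∑-rotate (λ b → H b * H b) a))) (∑-*ˡ (upTo L) 2 _)))) ⟩
        ∑ (upTo L) (λ a → E + E + 2 * ∑ (upTo L) (λ b → H b * H ((a + b) % L)))
          ≡⟨ trans (∑-+ (upTo L) _ _) (cong₂ _+_ (trans (∑-const (upTo L) (E + E)) (cong (_* (E + E)) (length-upTo L)))
               (trans (∑-*ˡ (upTo L) 2 _) (cong (2 *_) cross))) ⟩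
        L * (E + E) + 2 * (μ * μ)
          ≡⟨ cong (_+ 2 * (μ * μ)) (regroup L E) ⟩
        2 * L * E + 2 * (μ * μ) ∎
        where
        H = hits as
        E = ∑ (upTo L) (λ b → H b * H b)
        regroup : ∀ l e → l * (e + e) ≡ 2 * l * e
        regroup = solve-∀
        cross : ∑ (upTo L) (λ a → ∑ (upTo L) (λ b → H b * H ((a + b) % L))) ≡ μ * μ
        cross = begin
          ∑ (upTo L) (λ a → ∑ (upTo L) (λ b → H b * H ((a + b) % L)))
            ≡⟨ ∑-comm (upTo L) (upTo L) _ ⟩
          ∑ (upTo L) (λ b → ∑ (upTo L) (λ a → H b * H ((a + b) % L)))
            ≡⟨ ∑-cong (upTo L) (λ b → trans (∑-*ˡ (upTo L) (H b) _) (cong (H b *_) (trans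
                 (∑-cong (upTo L) (λ a → cong (λ i → H (i % L)) (+-comm a b))) (∑-rotate H b)))) ⟩
          ∑ (upTo L) (λ b → H b * ∑ (upTo L) H)
            ≡⟨ ∑-*ʳ (upTo L) (∑ (upTo L) H) H ⟩
          ∑ (upTo L) H * ∑ (upTo L) H
            ≡⟨ cong₂ _*_ (∑-hits as) (∑-hits as) ⟩
          μ * μ ∎

    hitsAt : ∀ {k} → Vec ℕ (suc k) → ℕ
    hitsAt (b ∷ as) = hits as b

    -- The expected number of hits is 2^k · `total` / L; the factor L clears the denominator.
    deviation : ∀ {k} → Vec ℕ (suc k) → ℕ
    deviation {k} s = ∣ L * hitsAt s - 2 ^ k * total ∣

    module _ (h≤1 : ∀ i → h i ≤ 1) where

      -- Divided by L^(k+2) this reads: the mean square of the hits is at most the mean plus its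
      -- square, as for independent samples. The base case is where h is 0 or 1, so that h² = h.
      moment≤ : ∀ k → L * moment k ≤ (2 * L) ^ k * (L * total) + L ^ k * (2 ^ k * total * (2 ^ k * total))
      moment≤ zero = begin
        L * moment 0            ≡⟨ cong (L *_) (trans (+-identityʳ _) (∑-cong (upTo L) (λ b →
                                     trans (cong₂ _*_ (+-identityʳ (h b)) (+-identityʳ (h b))) (idem (h b) (h≤1 b))))) ⟩
        L * total               ≤⟨ m≤m+n (L * total) _ ⟩
        L * total + (1 * total * (1 * total)) ≡⟨ cong₂ _+_ (sym (*-identityˡ (L * total))) (sym (*-identityˡ (1 * total * (1 * total)))) ⟩
        1 * (L * total) + 1 * (1 * total * (1 * total)) ∎
        where
        open ≤-Reasoning
        idem : ∀ b → b ≤ 1 → b * b ≡ b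
        idem 0 _ = refl
        idem 1 _ = refl
        idem (suc (suc _)) (s≤s ())
      moment≤ (suc k) = begin
        L * moment (suc k)
          ≡⟨ cong (L *_) (moment-suc k) ⟩
        L * (2 * L * moment k + P * (2 * (m * c * (m * c))))
          ≡⟨ pull L (moment k) P (m * c) ⟩
        2 * L * (L * moment k) + 2 * (L * P) * (m * c * (m * c))
          ≤⟨ +-monoˡ-≤ _ (*-monoʳ-≤ (2 * L) (moment≤ k)) ⟩
        2 * L * ((2 * L) ^ k * (L * c) + P * (m * c * (m * c))) + 2 * (L * P) * (m * c * (m * c))
          ≡⟨ collect L ((2 * L) ^ k) P m c ⟩
        (2 * L) ^ suc k * (L * c) + L ^ suc k * (2 ^ suc k * c * (2 ^ suc k * c)) ∎
        where
        open ≤-Reasoning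
        P = L ^ k
        m = 2 ^ k
        c = total
        pull : ∀ l v p t → l * (2 * l * v + p * (2 * (t * t))) ≡ 2 * l * (l * v) + 2 * (l * p) * (t * t)
        pull = solve-∀
        collect : ∀ l q p m c → 2 * l * (q * (l * c) + p * (m * c * (m * c))) + 2 * (l * p) * (m * c * (m * c))
                  ≡ 2 * l * q * (l * c) + l * p * (2 * m * c * (2 * m * c))
        collect = solve-∀

      ∣-∣-square : ∀ u v → ∣ u - v ∣ * ∣ u - v ∣ + 2 * (u * v) ≡ u * u + v * v
      ∣-∣-square zero    v       = +-identityʳ (v * v)
      ∣-∣-square (suc u) zero    = cong (suc u * suc u +_) (trans (cong (2 *_) (*-zeroʳ u)) refl)
      ∣-∣-square (suc u) (suc v) = trans (shift u v (∣ u - v ∣ * ∣ u - v ∣))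
        (trans (cong (_+ 2 * suc (u + v)) (∣-∣-square u v)) (unshift u v))
        where
        shift : ∀ u v d → d + 2 * (suc u * suc v) ≡ d + 2 * (u * v) + 2 * suc (u + v)
        shift = solve-∀
        unshift : ∀ u v → u * u + v * v + 2 * suc (u + v) ≡ suc u * suc u + suc v * suc v
        unshift = solve-∀

      total≤ : total ≤ L
      total≤ = ≤-trans (∑-mono (upTo L) h≤1) (≤-reflexive (trans (∑-one (upTo L)) (length-upTo L)))

      -- Mean square minus squared mean, the latter added on both sides instead of subtracted. The
      -- mean of 2^k · `total` / L hits is at most 2^k, so each of the L^(k+1) seeds contributes L²
      -- 2^k on average at most, L² being the scale of `deviation`.
      variance≤ : ∀ k → ∑ (seeds (suc k)) (λ s → deviation s * deviation s) ≤ L * L * (2 ^ k * L ^ suc k)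
      variance≤ k = +-cancelʳ-≤ (L * P * (t * t)) _ _ (begin
        D + L * P * (t * t)
          ≡⟨ +-cancelʳ-≡ (L * P * (t * t)) _ _ balance ⟩
        L * (L * moment k)
          ≤⟨ *-monoʳ-≤ L (moment≤ k) ⟩
        L * ((2 * L) ^ k * (L * total) + P * (t * t))
          ≡⟨ collect L ((2 * L) ^ k) total P (t * t) ⟩
        L * L * ((2 * L) ^ k * total) + L * P * (t * t)
          ≤⟨ +-monoˡ-≤ _ (*-monoʳ-≤ (L * L) (*-monoʳ-≤ ((2 * L) ^ k) total≤)) ⟩
        L * L * ((2 * L) ^ k * L) + L * P * (t * t)
          ≡⟨ cong (λ q → L * L * q + L * P * (t * t)) (trans (cong (_* L) (^-distribʳ-* k 2 L))
               (trans (*-assoc (2 ^ k) P L) (cong (2 ^ k *_) (*-comm P L)))) ⟩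
        L * L * (2 ^ k * L ^ suc k) + L * P * (t * t) ∎)
        where
        open ≤-Reasoning
        P = L ^ k
        t = 2 ^ k * total
        D = ∑ (seeds (suc k)) (λ s → deviation s * deviation s)
        collect : ∀ l q c p v → l * (q * (l * c) + p * v) ≡ l * l * (q * c) + l * p * v
        collect = solve-∀
        ∑-seeds : ∀ f → ∑ (seeds (suc k)) f ≡ ∑ (seeds k) (λ as → ∑ (upTo L) (λ b → f (b ∷ as)))
        ∑-seeds f = trans (∑-vecs-suc (upTo L) k f) (∑-comm (upTo L) (seeds k) _)
        crossed : ∑ (seeds (suc k)) (λ s → 2 * (L * hitsAt s * t)) ≡ P * (2 * L * t * t)
        crossed = trans (∑-seeds _) (trans (∑-cong (seeds k) (λ as → trans
          (trans (∑-cong (upTo L) (λ b → reorder L (hits as b) t)) (∑-*ˡ (upTo L) (2 * L * t) (hits as)))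
          (cong (2 * L * t *_) (∑-hits as)))) (trans (∑-const (seeds k) _) (cong (_* (2 * L * t * t)) (length-seeds k))))
          where
          reorder : ∀ l h t → 2 * (l * h * t) ≡ 2 * l * t * h
          reorder = solve-∀
        squares : ∑ (seeds (suc k)) (λ s → L * hitsAt s * (L * hitsAt s) + t * t) ≡ L * (L * moment k) + L * P * (t * t)
        squares = trans (∑-+ (seeds (suc k)) (λ s → L * hitsAt s * (L * hitsAt s)) (λ _ → t * t)) (cong₂ _+_
          (trans (∑-seeds _) (trans (∑-cong (seeds k) (λ as → trans (∑-cong (upTo L) (λ b → reorder L (hits as b)))
            (∑-*ˡ (upTo L) (L * L) _))) (trans (∑-*ˡ (seeds k) (L * L) _) (*-assoc L L (moment k)))))
          (trans (∑-const (seeds (suc k)) (t * t)) (cong (_* (t * t)) (length-seeds (suc k)))))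
          where
          reorder : ∀ l h → l * h * (l * h) ≡ l * l * (h * h)
          reorder = solve-∀
        balance : D + L * P * (t * t) + L * P * (t * t) ≡ L * (L * moment k) + L * P * (t * t)
        balance = begin-equality
          D + L * P * (t * t) + L * P * (t * t)
            ≡⟨ merge D L P t ⟩
          D + P * (2 * L * t * t)
            ≡⟨ cong (D +_) (sym crossed) ⟩
          D + ∑ (seeds (suc k)) (λ s → 2 * (L * hitsAt s * t))
            ≡⟨ sym (∑-+ (seeds (suc k)) _ _) ⟩
          ∑ (seeds (suc k)) _
            ≡⟨ ∑-cong (seeds (suc k)) (λ s → ∣-∣-square (L * hitsAt s) t) ⟩
          ∑ (seeds (suc k)) _
            ≡⟨ squares ⟩
          L * (L * moment k) + L * P * (t * t) ∎
          where
          merge : ∀ d l p t → d + l * p * (t * t) + l * p * (t * t) ≡ d + p * (2 * l * t * t)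
          merge = solve-∀

      -- Chebyshev's inequality
      deviations≤ : ∀ k K σ .{{_ : NonZero K}} .{{_ : NonZero σ}} → 2 ^ k ≡ K * (σ * σ) →
                    K * ∑ (seeds (suc k)) (λ s → bit (K * σ * L ≤ᵇ deviation s)) ≤ L ^ suc k
      deviations≤ k K σ eq = *-cancelˡ-≤ (K * (σ * σ) * (L * L)) (begin
        K * (σ * σ) * (L * L) * (K * ∑ (seeds (suc k)) (λ s → bit (τ ≤ᵇ deviation s)))
          ≡⟨ gather K σ L _ ⟩
        τ * τ * ∑ (seeds (suc k)) (λ s → bit (τ ≤ᵇ deviation s))
          ≡⟨ sym (∑-*ˡ (seeds (suc k)) (τ * τ) _) ⟩
        ∑ (seeds (suc k)) (λ s → τ * τ * bit (τ ≤ᵇ deviation s))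
          ≤⟨ ∑-mono (seeds (suc k)) (λ s → markov (deviation s)) ⟩
        ∑ (seeds (suc k)) (λ s → deviation s * deviation s)
          ≤⟨ variance≤ k ⟩
        L * L * (2 ^ k * L ^ suc k)
          ≡⟨ cong (λ m → L * L * (m * L ^ suc k)) eq ⟩
        L * L * (K * (σ * σ) * L ^ suc k)
          ≡⟨ swap (L * L) (K * (σ * σ)) (L ^ suc k) ⟩
        K * (σ * σ) * (L * L) * L ^ suc k ∎)
        where
        open ≤-Reasoning
        τ = K * σ * L
        instance
          _ : NonZero (K * (σ * σ) * (L * L))
          _ = m*n≢0 (K * (σ * σ)) (L * L) {{m*n≢0 K (σ * σ) {{it}} {{m*n≢0 σ σ}}}} {{m*n≢0 L L}}
        gather : ∀ k s l n → k * (s * s) * (l * l) * (k * n) ≡ k * s * l * (k * s * l) * n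
        gather = solve-∀
        swap : ∀ l m r → l * (m * r) ≡ m * l * r
        swap = solve-∀
        markov : ∀ d → τ * τ * bit (τ ≤ᵇ d) ≤ d * d
        markov d with τ ≤ᵇ d in le
        ... | false = ≤-trans (≤-reflexive (*-zeroʳ (τ * τ))) z≤n
        ... | true  = ≤-trans (≤-reflexive (*-identityʳ (τ * τ))) (*-mono-≤ τ≤d τ≤d)
          where
          τ≤d : τ ≤ d
          τ≤d = ≤ᵇ⇒≤ τ d (subst T (sym le) _)

-- Counting and averaging over lists

∑≡0⇒ : ∀ (as : List A) {f} → ∑ as f ≡ 0 → ∀ {a} → a ∈ as → f a ≡ 0
∑≡0⇒ (a ∷ as) {f} eq (here refl) = m+n≡0⇒m≡0 (f a) eq
∑≡0⇒ (a ∷ as) {f} eq (there a∈)  = ∑≡0⇒ as (m+n≡0⇒n≡0 (f a) eq) a∈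

∑-Any : ∀ (as : List A) {g : A → Bool} → Any (λ a → g a ≡ true) as → 1 ≤ ∑ as (bit ∘ g)
∑-Any (a ∷ as) (here eq) = ≤-trans (≤-reflexive (cong bit (sym eq))) (m≤m+n _ _)
∑-Any (a ∷ as) (there p) = ≤-trans (∑-Any as p) (m≤n+m _ _)

∑-mono-∈ : ∀ (as : List A) {f g : A → ℕ} → (∀ {a} → a ∈ as → f a ≤ g a) → ∑ as f ≤ ∑ as g
∑-mono-∈ []       le = z≤n
∑-mono-∈ (a ∷ as) le = +-mono-≤ (le (here refl)) (∑-mono-∈ as (le ∘ there))

≤ᵇ-false⁻ : ∀ m n → (m ≤ᵇ n) ≡ false → n < m
≤ᵇ-false⁻ m n eq = ≰⇒> (λ m≤n → subst T eq (≤⇒≤ᵇ m≤n))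

averaging : ∀ (as : List A) f c → 0 < length as → ∑ as f ≤ length as * c → ∃ λ a → a ∈ as × f a ≤ c
averaging (a ∷ as) f c _ le with f a ≤? c
averaging (a ∷ as)      f c _ le | yes fa≤c = a , here refl , fa≤c
averaging (a ∷ [])      f c _ le | no  fa≰c = contradiction (subst₂ _≤_ (+-identityʳ (f a)) (+-identityʳ c) le) fa≰c
averaging (a ∷ b ∷ as)  f c _ le | no  fa≰c with averaging (b ∷ as) f c (s≤s z≤n)
  (+-cancelˡ-≤ c _ _ (≤-trans (+-monoˡ-≤ _ (<⇒≤ (≰⇒> fa≰c))) le))
... | a′ , a′∈ , le′ = a′ , there a′∈ , le′

vecs-∈ : ∀ {as : List A} {k} (v : Vec A k) → All (_∈ as) (toList v) → v ∈ vecs as k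
vecs-∈ []      []       = here refl
vecs-∈ {k = suc k} (a ∷ v) (a∈ ∷ v∈) =
  ∈-concatMap⁺ _ (Any.map (λ { refl → ∈-map⁺ (a ∷_) (vecs-∈ v v∈) }) a∈)

-- Covering the seed space by translates, as in Lautemann's proof that BPP ⊆ Σ₂

module _ (L : ℕ) .{{_ : NonZero L}} where

  private
    infixl 6 _⊞_
    _⊞_ : ∀ {k} → Vec ℕ k → Vec ℕ k → Vec ℕ k
    _⊞_ = _⊕_ L

  Covers : ∀ {k r} → (Vec ℕ k → Bool) → Vec (Vec ℕ k) r → Vec ℕ k → Set
  Covers y U s = Any (λ u → y (s ⊞ u) ≡ true) (toList U)

  ∑-translate′ : ∀ {k} (s : Vec ℕ k) f → ∑ (seeds L k) (λ u → f (u ⊞ s)) ≡ ∑ (seeds L k) f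
  ∑-translate′ {k} s f = trans (∑-cong (seeds L k) (λ u → cong f (⊕-comm L u s))) (∑-translate L s f)

  -- For each s the translate of s by a uniform u is uniform, so y rejects it with probability at
  -- most 1/2. On average over u at most half of the weight z stays uncovered, and some u is no
  -- worse than average.
  halve : ∀ {k} (y : Vec ℕ k → Bool) → 2 * ∑ (seeds L k) (bit ∘ not ∘ y) ≤ L ^ k → ∀ z →
          ∃ λ u → u ∈ seeds L k × 2 * ∑ (seeds L k) (λ s → z s * bit (not (y (s ⊞ u)))) ≤ ∑ (seeds L k) z
  halve {k} y few z = averaging (seeds L k) (λ u → 2 * ∑ (seeds L k) (z′ u)) (∑ (seeds L k) z)
      (subst (0 <_) (sym (length-seeds L k)) (m^n>0 L k)) average
    where
    z′ : Vec ℕ k → Vec ℕ k → ℕ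
    z′ u s = z s * bit (not (y (s ⊞ u)))
    average : ∑ (seeds L k) (λ u → 2 * ∑ (seeds L k) (z′ u)) ≤ length (seeds L k) * ∑ (seeds L k) z
    average = begin
      ∑ (seeds L k) (λ u → 2 * ∑ (seeds L k) (z′ u))
        ≡⟨ trans (∑-*ˡ (seeds L k) 2 _) (cong (2 *_) (∑-comm (seeds L k) (seeds L k) z′)) ⟩
      2 * ∑ (seeds L k) (λ s → ∑ (seeds L k) (λ u → z s * bit (not (y (s ⊞ u)))))
        ≡⟨ cong (2 *_) (∑-cong (seeds L k) (λ s → trans (∑-*ˡ (seeds L k) (z s) _)
             (cong (z s *_) (∑-translate L s (bit ∘ not ∘ y))))) ⟩
      2 * ∑ (seeds L k) (λ s → z s * ∑ (seeds L k) (bit ∘ not ∘ y))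
        ≡⟨ cong (2 *_) (∑-*ʳ (seeds L k) (∑ (seeds L k) (bit ∘ not ∘ y)) z) ⟩
      2 * (∑ (seeds L k) z * ∑ (seeds L k) (bit ∘ not ∘ y))
        ≡⟨ swap (∑ (seeds L k) z) _ ⟩
      2 * ∑ (seeds L k) (bit ∘ not ∘ y) * ∑ (seeds L k) z
        ≤⟨ *-monoˡ-≤ (∑ (seeds L k) z) few ⟩
      L ^ k * ∑ (seeds L k) z
        ≡⟨ cong (_* ∑ (seeds L k) z) (sym (length-seeds L k)) ⟩
      length (seeds L k) * ∑ (seeds L k) z ∎
      where
      open ≤-Reasoning
      swap : ∀ a b → 2 * (a * b) ≡ 2 * b * a
      swap = solve-∀

  -- The weight z lives on the seeds not yet covered. Each translate halves it, so r of them bring a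
  -- weight below 2^r to 0.
  cover : ∀ {k} (y : Vec ℕ k → Bool) → 2 * ∑ (seeds L k) (bit ∘ not ∘ y) ≤ L ^ k →
          ∀ r (z : Vec ℕ k → ℕ) → ∑ (seeds L k) z < 2 ^ r →
          Σ (Vec (Vec ℕ k) r) λ U → All (_∈ seeds L k) (toList U) ×
            (∀ s → s ∈ seeds L k → z s ≡ 0 ⊎ Covers y U s)
  cover {k} y few zero    z small = [] , [] , λ s s∈ → inj₁ (∑≡0⇒ (seeds L k) (n<1⇒n≡0 small) s∈)
  cover {k} y few (suc r) z small =
    let u , u∈ , half   = halve y few z
        U , U∈ , covers = cover y few r (λ s → z s * bit (not (y (s ⊞ u)))) (*-cancelˡ-< 2 _ _ (≤-<-trans half small))
    in u ∷ U , u∈ ∷ U∈ , λ s s∈ → extend u U s (covers s s∈)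
    where
    extend : ∀ {r} u (U : Vec (Vec ℕ k) r) s → z s * bit (not (y (s ⊞ u))) ≡ 0 ⊎ Covers y U s →
             z s ≡ 0 ⊎ Covers y (u ∷ U) s
    extend u U s (inj₂ c) = inj₂ (there c)
    extend u U s (inj₁ eq) with m*n≡0⇒m≡0∨n≡0 (z s) eq
    ... | inj₁ z≡0 = inj₁ z≡0
    ... | inj₂ b≡0 = inj₂ (here (uncovered (y (s ⊞ u)) b≡0))
      where
      uncovered : ∀ b → bit (not b) ≡ 0 → b ≡ true
      uncovered true _ = refl

  -- A union bound: each single translate covers exactly as many seeds as y accepts.
  covers⇒many : ∀ {k r} (y : Vec ℕ k → Bool) (U : Vec (Vec ℕ k) r) → (∀ s → s ∈ seeds L k → Covers y U s) →
                L ^ k ≤ r * ∑ (seeds L k) (bit ∘ y)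
  covers⇒many {k} {r} y U covers = begin
    L ^ k                                                          ≡⟨ sym (length-seeds L k) ⟩
    length (seeds L k)                                             ≡⟨ sym (∑-one (seeds L k)) ⟩
    ∑ (seeds L k) (λ _ → 1)                                        ≤⟨ ∑-mono-∈ (seeds L k) (λ s∈ → ∑-Any (toList U) (covers _ s∈)) ⟩
    ∑ (seeds L k) (λ s → ∑ (toList U) (λ u → bit (y (s ⊞ u))))     ≡⟨ ∑-comm (seeds L k) (toList U) _ ⟩
    ∑ (toList U) (λ u → ∑ (seeds L k) (λ s → bit (y (s ⊞ u))))     ≡⟨ ∑-cong (toList U) (λ u → ∑-translate′ u (bit ∘ y)) ⟩
    ∑ (toList U) (λ u → ∑ (seeds L k) (bit ∘ y))                   ≡⟨ ∑-const (toList U) _ ⟩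
    length (toList U) * ∑ (seeds L k) (bit ∘ y)                    ≡⟨ cong (_* ∑ (seeds L k) (bit ∘ y)) (length-toList U) ⟩
    r * ∑ (seeds L k) (bit ∘ y)                                    ∎
    where open ≤-Reasoning

  near : ℕ → ℕ → ℕ → ℕ → Bool
  near k τ c v = not (τ ≤ᵇ ∣ L * v - 2 ^ k * c ∣)

  module _ (h : ℕ → ℕ) (h≤1 : ∀ i → h i ≤ 1)
           {k r K σ : ℕ} .{{_ : NonZero K}} .{{_ : NonZero σ}} (2^k≡Kσ² : 2 ^ k ≡ K * (σ * σ)) where

    private
      T′ : ℕ
      T′ = K * σ * L

    estimate-complete : 2 ≤ K → L ^ suc k < 2 ^ r →
      Σ (Vec (Vec ℕ (suc k)) r) λ U → All (_∈ seeds L (suc k)) (toList U) ×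
        (∀ s → s ∈ seeds L (suc k) → Covers (near k T′ (total L h) ∘ hitsAt L h) U s)
    estimate-complete 2≤K enough with cover (near k T′ (total L h) ∘ hitsAt L h) few r (λ _ → 1)
        (subst (_< 2 ^ r) (sym (trans (∑-one (seeds L (suc k))) (length-seeds L (suc k)))) enough)
      where
      few : 2 * ∑ (seeds L (suc k)) (bit ∘ not ∘ near k T′ (total L h) ∘ hitsAt L h) ≤ L ^ suc k
      few = ≤-trans (*-mono-≤ 2≤K (≤-reflexive (∑-cong (seeds L (suc k)) (λ s → cong bit (not-involutive _)))))
                    (deviations≤ L h h≤1 k K σ 2^k≡Kσ²)
    ... | U , U∈ , covers = U , U∈ , λ s s∈ → strict (covers s s∈)
      where
      strict : ∀ {X : Set} → 1 ≡ 0 ⊎ X → X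
      strict (inj₂ x) = x

    -- If c missed the total by 2L/σ, the two scaled means would lie 2 `T′` apart, and every seed
    -- near c would deviate from the true mean by `T′`. At most a fraction 1/K of the seeds does so,
    -- whereas r translates that cover everything need a fraction 1/r.
    estimate-sound : r < K → ∀ c (U : Vec (Vec ℕ (suc k)) r) →
      (∀ s → s ∈ seeds L (suc k) → Covers (near k T′ c ∘ hitsAt L h) U s) →
      σ * ∣ c - total L h ∣ < 2 * L
    estimate-sound r<K c U covers = ≰⇒> λ far → n≮n _ (begin-strict
      L ^ suc k                                                           ≤⟨ covers⇒many (near k T′ c ∘ hitsAt L h) U covers ⟩
      r * ∑ (seeds L (suc k)) (bit ∘ near k T′ c ∘ hitsAt L h)             ≤⟨ *-monoʳ-≤ r (∑-mono (seeds L (suc k)) (deviates far)) ⟩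
      r * #dev                                                            <⟨ *-monoˡ-< #dev {{>-nonZero (positive far)}} r<K ⟩
      K * #dev                                                            ≤⟨ deviations≤ L h h≤1 k K σ 2^k≡Kσ² ⟩
      L ^ suc k                                                           ∎)
      where
      open ≤-Reasoning
      #dev = ∑ (seeds L (suc k)) (λ s → bit (T′ ≤ᵇ deviation L h s))
      threshold : 2 * L ≤ σ * ∣ c - total L h ∣ → T′ + T′ ≤ ∣ 2 ^ k * c - 2 ^ k * total L h ∣
      threshold far = begin
        T′ + T′                                       ≡⟨ regroup K σ L ⟩
        K * σ * (2 * L)                               ≤⟨ *-monoʳ-≤ (K * σ) far ⟩
        K * σ * (σ * ∣ c - total L h ∣)           ≡⟨ regroup′ K σ _ ⟩
        K * (σ * σ) * ∣ c - total L h ∣           ≡⟨ cong (_* ∣ c - total L h ∣) (sym 2^k≡Kσ²) ⟩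
        2 ^ k * ∣ c - total L h ∣                 ≡⟨ *-distribˡ-∣-∣ (2 ^ k) c (total L h) ⟩
        ∣ 2 ^ k * c - 2 ^ k * total L h ∣         ∎
        where
        regroup : ∀ k s l → k * s * l + k * s * l ≡ k * s * (2 * l)
        regroup = solve-∀
        regroup′ : ∀ k s d → k * s * (s * d) ≡ k * (s * s) * d
        regroup′ = solve-∀
      deviates : 2 * L ≤ σ * ∣ c - total L h ∣ →
                 ∀ s → bit (near k T′ c (hitsAt L h s)) ≤ bit (T′ ≤ᵇ deviation L h s)
      deviates far s with T′ ≤ᵇ ∣ L * hitsAt L h s - 2 ^ k * c ∣ in close
      ... | true  = z≤n
      ... | false with T′ ≤ᵇ deviation L h s in dev
      ...   | true  = ≤-refl
      ...   | false = contradiction (threshold far) (<⇒≱ (begin-strict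
        ∣ 2 ^ k * c - 2 ^ k * total L h ∣
          ≤⟨ ∣-∣-triangle (2 ^ k * c) (L * hitsAt L h s) (2 ^ k * total L h) ⟩
        ∣ 2 ^ k * c - L * hitsAt L h s ∣ + deviation L h s
          ≡⟨ cong (_+ deviation L h s) (∣-∣-comm (2 ^ k * c) _) ⟩
        ∣ L * hitsAt L h s - 2 ^ k * c ∣ + deviation L h s
          <⟨ +-mono-< (≤ᵇ-false⁻ T′ _ close) (≤ᵇ-false⁻ T′ _ dev) ⟩
        T′ + T′ ∎))
      -- Strictness of r · #dev < K · #dev requires some deviating seed; without one the translates
      -- would cover nothing.
      positive : 2 * L ≤ σ * ∣ c - total L h ∣ → 0 < #dev
      positive far with #dev in eq
      ... | suc _ = s≤s z≤n
      ... | zero  = contradiction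
        (≤-trans (covers⇒many (near k T′ c ∘ hitsAt L h) U covers)
          (≤-trans (*-monoʳ-≤ r (∑-mono (seeds L (suc k)) (deviates far)))
            (≤-reflexive (trans (cong (r *_) eq) (*-zeroʳ r)))))
        (<⇒≱ (m^n>0 L (suc k)))

-- Conjunctions and disjunctions at a fixed input

module _ {n : ℕ} {x : Vec Bool n} where

  Holds : Fn n → Set
  Holds g = g x ≡ true

  and-true⁺ : ∀ {gs} → All Holds gs → product gs x ≡ true
  and-true⁺ []         = refl
  and-true⁺ (eq ∷ eqs) = cong₂ _∧_ eq (and-true⁺ eqs)

  and-true⁻ : ∀ gs → product gs x ≡ true → All Holds gs
  and-true⁻ []       eq = []
  and-true⁻ (g ∷ gs) eq with g x in gx
  ... | true = gx ∷ and-true⁻ gs eq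

  or-true⁺ : ∀ {gs} → Any Holds gs → or (gs at x) ≡ true
  or-true⁺ {g ∷ gs} (here eq) = cong (_∨ or (gs at x)) eq
  or-true⁺ {g ∷ gs} (there p) with g x
  ... | true  = refl
  ... | false = or-true⁺ p

  or-true⁻ : ∀ gs → or (gs at x) ≡ true → Any Holds gs
  or-true⁻ (g ∷ gs) eq with g x in gx
  ... | true  = here gx
  ... | false = there (or-true⁻ gs eq)

true⇔⇒≡ : ∀ {a b} → (a ≡ true → b ≡ true) → (b ≡ true → a ≡ true) → a ≡ b
true⇔⇒≡ {true}          f g = sym (f refl)
true⇔⇒≡ {false} {false} f g = refl
true⇔⇒≡ {false} {true}  f g = g refl

-- Inputs in blocks

positions : ∀ n → ℕ → List (Fin n)
positions zero    i       = []
positions (suc n) zero    = zero ∷ []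
positions (suc n) (suc i) = map suc (positions n i)

-- An index beyond the inputs has no position, which pads the input with zeros to a whole number of
-- blocks.
length-positions : ∀ n i → length (positions n i) ≤ 1
length-positions zero    i       = z≤n
length-positions (suc n) zero    = ≤-refl
length-positions (suc n) (suc i) = ≤-trans (≤-reflexive (length-map suc (positions n i))) (length-positions n i)

bit≤1 : ∀ b → bit b ≤ 1
bit≤1 true  = ≤-refl
bit≤1 false = z≤n

count≤length : ∀ {n} (ℓ : List (Fin n)) x → count ℓ x ≤ length ℓ
count≤length ℓ x = ≤-trans (∑-mono ℓ (λ i → bit≤1 (lookup x i))) (≤-reflexive (∑-one ℓ))

∑-positions : ∀ {n} N → n ≤ N → (x : Vec Bool n) → ∑ (upTo N) (λ i → count (positions n i) x) ≡ ones x
∑-positions N n≤N [] = ∑-zero (upTo N)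
∑-positions {suc n} (suc N) (s≤s n≤N) (b ∷ x) = trans (∑-upTo-suc N _) (trans
  (cong₂ _+_ (+-identityʳ (bit b)) (trans (∑-cong (upTo N) (λ i → ∑-map suc (positions n i) _)) (∑-positions N n≤N x)))
  (ones-∷ b))
  where
  ones-∷ : ∀ b → bit b + ones x ≡ ones (b ∷ x)
  ones-∷ true  = refl
  ones-∷ false = refl

∑-upTo-+ : ∀ m n f → ∑ (upTo (m + n)) f ≡ ∑ (upTo m) f + ∑ (upTo n) (λ i → f (m + i))
∑-upTo-+ zero    n f = refl
∑-upTo-+ (suc m) n f = begin
  ∑ (upTo (suc m + n)) f                             ≡⟨ ∑-upTo-suc (m + n) f ⟩
  f 0 + ∑ (upTo (m + n)) (f ∘ suc)                   ≡⟨ cong (f 0 +_) (∑-upTo-+ m n (f ∘ suc)) ⟩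
  f 0 + (∑ (upTo m) (f ∘ suc) + ∑ (upTo n) (λ i → f (suc m + i)))
    ≡⟨ sym (+-assoc (f 0) _ _) ⟩
  f 0 + ∑ (upTo m) (f ∘ suc) + ∑ (upTo n) (λ i → f (suc m + i))
    ≡⟨ cong (_+ ∑ (upTo n) (λ i → f (suc m + i))) (sym (∑-upTo-suc m f)) ⟩
  ∑ (upTo (suc m)) f + ∑ (upTo n) (λ i → f (suc m + i)) ∎
  where open ≡-Reasoning

-- Testing the value of a count with MOD gates

primeChecks : ∀ {n} p .{{_ : NonZero p}} → List (Fin n) → ℕ → ℕ → List (Fn n)
primeChecks p ℓ c Q = map (λ D → residue p (λ x → count ℓ x choose D) ((c choose D) % p)) (upTo Q)

-- The two fan-ins of a counting level in base m: that of the MOD gate with every wire repeated q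
-- times, and that of the AND gates below it.
Affordable : ℕ → ℕ → ℕ → ℕ → ℕ → Set
Affordable W N p q m = q * ((N * (p * p)) ^ m * (p * p) + p) ≤ W × m * 2 + 1 ≤ W

primeChecks-comp : ∀ {n W N} p q .{{_ : NonZero p}} .{{_ : NonZero q}} → p * q ≡ 42 → .{{_ : NonZero N}} →
  ∀ a t → Affordable W N p q (p ^ a) → ∀ (ℓ : List (Fin n)) → length ℓ ≤ N → ∀ c →
  All (Comp W (suc t * 2)) (primeChecks p ℓ c (p ^ (a * suc t)))
primeChecks-comp {W = W} {N} p q pq a t (size≤ , width≤) ℓ l c = All.map⁺ (All.map
  (λ {D} D< → Modular.residue-binomial W p q pq N (p ^ a) {{m^n≢0 p a}} size≤ width≤ t
    (subst (D <_) (sym (^-*-assoc p a (suc t))) D<) ℓ l (m%n<n (c choose D) p))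
  (All.all-upTo (p ^ (a * suc t))))

primeChecks-complete : ∀ {n} p .{{_ : NonZero p}} (ℓ : List (Fin n)) Q x →
  All (Holds {x = x}) (primeChecks p ℓ (count ℓ x) Q)
primeChecks-complete p ℓ Q x = All.map⁺ (All.universal (λ D → ≡ᵇ-refl ((count ℓ x choose D) % p)) (upTo Q))

primeChecks-sound : ∀ {n} p .{{_ : NonZero p}} → Prime p → ∀ a (ℓ : List (Fin n)) c x →
  All (Holds {x = x}) (primeChecks p ℓ c (p ^ a)) → p ^ a ∣ ∣ count ℓ x - c ∣
primeChecks-sound p p-prime a ℓ c x holds = C-residues⇒^∣ p-prime a (count ℓ x) c
  (λ D D< → ≡ᵇ-true⁻ ((count ℓ x choose D) % p) ((c choose D) % p) (All.lookup (All.map⁻ holds) (∈-upTo⁺ D<)))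

module Exponents (a₂ a₃ a₇ : ℕ) where

  modulus checkCount : ℕ → ℕ
  modulus t    = 2 ^ (a₂ * t) * 3 ^ (a₃ * t) * 7 ^ (a₇ * t)
  checkCount t = 2 ^ (a₂ * t) + (3 ^ (a₃ * t) + 7 ^ (a₇ * t))

  module _ {n : ℕ} where

    checks : List (Fin n) → ℕ → ℕ → List (Fn n)
    checks ℓ c t = primeChecks 2 ℓ c (2 ^ (a₂ * t)) ++ (primeChecks 3 ℓ c (3 ^ (a₃ * t)) ++ primeChecks 7 ℓ c (7 ^ (a₇ * t)))

    length-checks : ∀ ℓ c t → length (checks ℓ c t) ≡ checkCount t
    length-checks ℓ c t = trans (length-++ (primeChecks 2 ℓ c (2 ^ (a₂ * t))))
      (cong₂ _+_ (len 2 (2 ^ (a₂ * t))) (trans (length-++ (primeChecks 3 ℓ c (3 ^ (a₃ * t)))) (cong₂ _+_ (len 3 (3 ^ (a₃ * t))) (len 7 (7 ^ (a₇ * t))))))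
      where
      len : ∀ p .{{_ : NonZero p}} Q → length (primeChecks p ℓ c Q) ≡ Q
      len p Q = trans (length-map _ (upTo Q)) (length-upTo Q)

    checks-complete : ∀ ℓ t x → All (Holds {x = x}) (checks ℓ (count ℓ x) t)
    checks-complete ℓ t x = All.++⁺ (primeChecks-complete 2 ℓ (2 ^ (a₂ * t)) x)
      (All.++⁺ (primeChecks-complete 3 ℓ (3 ^ (a₃ * t)) x) (primeChecks-complete 7 ℓ (7 ^ (a₇ * t)) x))

    checks-sound : ∀ ℓ c t x → All (Holds {x = x}) (checks ℓ c t) → ∣ count ℓ x - c ∣ < modulus t → count ℓ x ≡ c
    checks-sound ℓ c t x holds = chinese-2-3-7 (a₂ * t) (a₃ * t) (a₇ * t)
      (primeChecks-sound 2 (from-yes (prime? 2)) (a₂ * t) ℓ c x (All.++⁻ˡ P₂ holds))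
      (primeChecks-sound 3 (from-yes (prime? 3)) (a₃ * t) ℓ c x (All.++⁻ˡ P₃ (All.++⁻ʳ P₂ holds)))
      (primeChecks-sound 7 (from-yes (prime? 7)) (a₇ * t) ℓ c x (All.++⁻ʳ P₃ (All.++⁻ʳ P₂ holds)))
      where
      P₂ = primeChecks 2 ℓ c (2 ^ (a₂ * t))
      P₃ = primeChecks 3 ℓ c (3 ^ (a₃ * t))

    checks-comp : ∀ {W N} .{{_ : NonZero N}} → Affordable W N 2 21 (2 ^ a₂) → Affordable W N 3 14 (3 ^ a₃) →
      Affordable W N 7 6 (7 ^ a₇) → ∀ ℓ → length ℓ ≤ N → ∀ c t → All (Comp W (suc t * 2)) (checks ℓ c (suc t))
    checks-comp A₂ A₃ A₇ ℓ l c t = All.++⁺ (primeChecks-comp 2 21 refl a₂ t A₂ ℓ l c)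
      (All.++⁺ (primeChecks-comp 3 14 refl a₃ t A₃ ℓ l c) (primeChecks-comp 7 6 refl a₇ t A₇ ℓ l c))

length-cartesianProduct : ∀ (as : List A) (bs : List B) → length (cartesianProduct as bs) ≡ length as * length bs
length-cartesianProduct []       bs = refl
length-cartesianProduct (a ∷ as) bs = trans (length-++ (map (a ,_) bs))
  (cong₂ _+_ (length-map (a ,_) bs) (length-cartesianProduct as bs))

-- The circuit

module Construction
  {n W N : ℕ} .{{_ : NonZero N}} (a₂ a₃ a₇ t : ℕ)
  (A₂ : Affordable W N 2 21 (2 ^ a₂)) (A₃ : Affordable W N 3 14 (3 ^ a₃)) (A₇ : Affordable W N 7 6 (7 ^ a₇))
  (β L κ K σ r : ℕ) .{{_ : NonZero L}} .{{_ : NonZero K}} .{{_ : NonZero σ}}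
  (n≤ : n ≤ β * L) (L≤N : L ≤ N) (M≤N : 2 ^ κ ≤ N)
  (2^κ≡Kσ² : 2 ^ κ ≡ K * (σ * σ)) (2≤K : 2 ≤ K) (r<K : r < K) (enough : L ^ suc κ < 2 ^ r)
  -- Sample counts use one counting level less than block counts. The two layers saved hold the
  -- disjunction over `choices` and the conjunction in each `attempt`.
  (M< : 2 ^ κ < Exponents.modulus a₂ a₃ a₇ (suc t)) (L< : 2 * L ≤ σ * Exponents.modulus a₂ a₃ a₇ (suc (suc t)))
  (sample≤ : r * suc (2 ^ κ) ≤ W) (check≤ : Exponents.checkCount a₂ a₃ a₇ (suc t) ≤ W)
  (tests≤ : β * (Exponents.checkCount a₂ a₃ a₇ (suc (suc t)) + L ^ suc κ) ≤ W)
  (guesses≤ : (suc L * (L ^ suc κ) ^ r) ^ β ≤ W)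
  where

  open Exponents a₂ a₃ a₇

  Seed : Set
  Seed = Vec ℕ (suc κ)

  at′ : ℕ → ℕ → List (Fin n)
  at′ j i = positions n (j * L + i)

  marked : Vec Bool n → ℕ → ℕ → ℕ
  marked x j i = count (at′ j i) x

  marked≤1 : ∀ x j i → marked x j i ≤ 1
  marked≤1 x j i = ≤-trans (count≤length (at′ j i) x) (length-positions n (j * L + i))

  block : ℕ → List (Fin n)
  block j = concatMap (at′ j) (upTo L)

  sample : ℕ → Seed → List (Fin n)
  sample j (b ∷ as) = concatMap (at′ j) (points L as b)

  length-at : ∀ j is → length (concatMap (at′ j) is) ≤ length is
  length-at j is = ≤-trans (length-concatMap≤ (at′ j) (All.universal (λ i → length-positions n (j * L + i)) is))
                           (≤-reflexive (*-identityʳ (length is)))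

  length-block : ∀ j → length (block j) ≤ L
  length-block j = ≤-trans (length-at j (upTo L)) (≤-reflexive (length-upTo L))

  length-sample : ∀ j s → length (sample j s) ≤ 2 ^ κ
  length-sample j (b ∷ as) = ≤-trans (length-at j (points L as b)) (≤-reflexive (length-points L as b))

  count-block : ∀ j x → count (block j) x ≡ total L (marked x j)
  count-block j x = ∑-concatMap (at′ j) (upTo L) _

  count-sample : ∀ j s x → count (sample j s) x ≡ hitsAt L (marked x j) s
  count-sample j (b ∷ as) x = ∑-concatMap (at′ j) (points L as b) _

  near′ : ℕ → ℕ → Bool
  near′ = near L κ (K * σ * L)

  -- Both c and v are constants of the formula, so nearness is decided while it is built and costs
  -- no gates.
  window : ℕ → List ℕ
  window c = filter (λ v → T? (near′ c v)) (upTo (suc (2 ^ κ)))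

  choices : ℕ → Vec Seed r → List (Seed × ℕ)
  choices c U = cartesianProduct (toList U) (window c)

  attempt : ℕ → Seed → Seed × ℕ → Fn n
  attempt j s (u , v) = product (checks (sample j (_⊕_ L s u)) v (suc t))

  sampleTest : ℕ → ℕ → Vec Seed r → Seed → Fn n
  sampleTest j c U s x = or (map (attempt j s) (choices c U) at x)

  sampleTest-comp : ∀ j c U s → Comp W (suc (suc t) * 2) (sampleTest j c U s)
  sampleTest-comp j c U s = comp-node disj len (All.map⁺ (All.universal (λ (u , v) →
      comp-node conj (≤-trans (≤-reflexive (length-checks (sample j (_⊕_ L s u)) v (suc t))) check≤)
        (checks-comp A₂ A₃ A₇ (sample j (_⊕_ L s u)) (≤-trans (length-sample j (_⊕_ L s u)) M≤N) v t)) (choices c U)))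
    where
    len : length (map (attempt j s) (choices c U)) ≤ W
    len = begin
      length (map (attempt j s) (choices c U)) ≡⟨ trans (length-map _ (choices c U)) (length-cartesianProduct (toList U) (window c)) ⟩
      length (toList U) * length (window c)    ≤⟨ *-mono-≤ (≤-reflexive (length-toList U))
        (≤-trans (length-filter (λ v → T? (near′ c v)) (upTo (suc (2 ^ κ)))) (≤-reflexive (length-upTo (suc (2 ^ κ))))) ⟩
      r * suc (2 ^ κ)                          ≤⟨ sample≤ ⟩
      W                                        ∎
      where open ≤-Reasoning

  module _ (x : Vec Bool n) where

    sampleTest-sound : ∀ j c U s → Holds {x = x} (sampleTest j c U s) → Covers L (near′ c ∘ hitsAt L (marked x j)) U s
    sampleTest-sound j c U s holds with find (Any.map⁻ (or-true⁻ (map (attempt j s) (choices c U)) holds))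
    ... | (u , v) , uv∈ , eq with ∈-cartesianProduct⁻ (toList U) (window c) uv∈
    ... | u∈ , v∈ with ∈-filter⁻ (λ v → T? (near′ c v)) {xs = upTo (suc (2 ^ κ))} v∈
    ... | v∈upTo , is-near = lose u∈ (trans (cong (near′ c) (trans (sym (count-sample j s′ x)) exact)) (Equivalence.to T-≡ is-near))
      where
      s′ = _⊕_ L s u
      -- Both numbers are at most the sample size 2^κ, hence differ by less than the modulus.
      exact : count (sample j s′) x ≡ v
      exact = checks-sound (sample j s′) v (suc t) x (and-true⁻ _ eq) (≤-<-trans (≤-trans (∣m-n∣≤m⊔n _ v)
        (⊔-lub (≤-trans (count≤length (sample j s′) x) (length-sample j s′)) (s≤s⁻¹ (∈-upTo⁻ v∈upTo)))) M<)

    sampleTest-complete : ∀ j c U s → Covers L (near′ c ∘ hitsAt L (marked x j)) U s → Holds {x = x} (sampleTest j c U s)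
    sampleTest-complete j c U s covers with find covers
    ... | u , u∈ , is-near = or-true⁺ {gs = map (attempt j s) (choices c U)} (Any.map⁺ (lose
        (∈-cartesianProduct⁺ u∈ (∈-filter⁺ (λ v → T? (near′ c v)) (∈-upTo⁺ (s≤s v≤))
          (Equivalence.from T-≡ (trans (cong (near′ c) (count-sample j s′ x)) is-near))))
        (and-true⁺ (checks-complete (sample j s′) (suc t) x))))
      where
      s′ = _⊕_ L s u
      v≤ : count (sample j s′) x ≤ 2 ^ κ
      v≤ = ≤-trans (count≤length (sample j s′) x) (length-sample j s′)

  Guess : Set
  Guess = ℕ × Vec Seed r

  blockTests : ℕ → Guess → List (Fn n)
  blockTests j (c , U) = checks (block j) c (suc (suc t)) ++ map (sampleTest j c U) (seeds L (suc κ))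

  blockTests-comp : ∀ j g → All (Comp W (suc (suc t) * 2)) (blockTests j g)
  blockTests-comp j (c , U) = All.++⁺
    (checks-comp A₂ A₃ A₇ (block j) (≤-trans (length-block j) L≤N) c (suc t))
    (All.map⁺ (All.universal (sampleTest-comp j c U) (seeds L (suc κ))))

  length-blockTests : ∀ j g → length (blockTests j g) ≡ checkCount (suc (suc t)) + L ^ suc κ
  length-blockTests j (c , U) = trans (length-++ (checks (block j) c (suc (suc t)))) (cong₂ _+_
    (length-checks (block j) c (suc (suc t))) (trans (length-map _ (seeds L (suc κ))) (length-seeds L (suc κ))))

  blockTests-sound : ∀ x j g → All (Holds {x = x}) (blockTests j g) → total L (marked x j) ≡ proj₁ g
  blockTests-sound x j (c , U) holds = trans (sym (count-block j x))
    (checks-sound (block j) c (suc (suc t)) x (All.++⁻ˡ exactTests holds) (begin-strict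
      ∣ count (block j) x - c ∣        ≡⟨ cong (λ m → ∣ m - c ∣) (count-block j x) ⟩
      ∣ total L (marked x j) - c ∣     ≡⟨ ∣-∣-comm (total L (marked x j)) c ⟩
      ∣ c - total L (marked x j) ∣     <⟨ *-cancelˡ-< σ _ _ (<-≤-trans (estimate-sound L (marked x j) (marked≤1 x j)
                                            2^κ≡Kσ² r<K c U covers) L<) ⟩
      modulus (suc (suc t))            ∎))
    where
    open ≤-Reasoning
    exactTests = checks (block j) c (suc (suc t))
    covers : ∀ s → s ∈ seeds L (suc κ) → Covers L (near′ c ∘ hitsAt L (marked x j)) U s
    covers s s∈ = sampleTest-sound x j c U s (All.lookup (All.map⁻ (All.++⁻ʳ exactTests holds)) s∈)

  guesses : List Guess
  guesses = cartesianProduct (upTo (suc L)) (vecs (seeds L (suc κ)) r)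

  length-guesses : length guesses ≡ suc L * (L ^ suc κ) ^ r
  length-guesses = trans (length-cartesianProduct (upTo (suc L)) (vecs (seeds L (suc κ)) r))
    (cong₂ _*_ (length-upTo (suc L)) (trans (length-vecs (seeds L (suc κ)) r) (cong (_^ r) (length-seeds L (suc κ)))))

  blockTests-holds : ∀ x j (U : Vec Seed r) →
    (∀ s → s ∈ seeds L (suc κ) → Covers L (near′ (total L (marked x j)) ∘ hitsAt L (marked x j)) U s) →
    All (Holds {x = x}) (blockTests j (total L (marked x j) , U))
  blockTests-holds x j U covers = All.++⁺
    (subst (λ c → All (Holds {x = x}) (checks (block j) c (suc (suc t)))) (count-block j x)
      (checks-complete (block j) (suc (suc t)) x))
    (All.map⁺ (All.tabulate (λ {s} s∈ → sampleTest-complete x j (total L (marked x j)) U s (covers s s∈))))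

  guess-∈ : ∀ {c U} → c ≤ L → All (_∈ seeds L (suc κ)) (toList U) → (c , U) ∈ guesses
  guess-∈ {U = U} c≤ U∈ = ∈-cartesianProduct⁺ (∈-upTo⁺ (s≤s c≤)) (vecs-∈ U U∈)

  blockTests-complete : ∀ x j → ∃ λ g → g ∈ guesses × All (Holds {x = x}) (blockTests j g)
  blockTests-complete x j =
    let U , U∈ , covers = estimate-complete L (marked x j) (marked≤1 x j) 2^κ≡Kσ² 2≤K enough
    in (total L (marked x j) , U) , guess-∈ (total≤ L (marked x j) (marked≤1 x j)) U∈ , blockTests-holds x j U covers

  claimed : ∀ {b} → Vec Guess b → ℕ
  claimed []            = 0
  claimed ((c , U) ∷ G) = c + claimed G

  tests : ∀ {b} → ℕ → Vec Guess b → List (Fn n)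
  tests j []      = []
  tests j (g ∷ G) = blockTests j g ++ tests (suc j) G

  tests-comp : ∀ {b} j (G : Vec Guess b) → All (Comp W (suc (suc t) * 2)) (tests j G)
  tests-comp j []      = []
  tests-comp j (g ∷ G) = All.++⁺ (blockTests-comp j g) (tests-comp (suc j) G)

  length-tests : ∀ {b} j (G : Vec Guess b) → length (tests j G) ≡ b * (checkCount (suc (suc t)) + L ^ suc κ)
  length-tests j []      = refl
  length-tests j (g ∷ G) = trans (length-++ (blockTests j g)) (cong₂ _+_ (length-blockTests j g) (length-tests (suc j) G))

  blockTotals : Vec Bool n → ℕ → ℕ → ℕ
  blockTotals x j zero    = 0
  blockTotals x j (suc b) = total L (marked x j) + blockTotals x (suc j) b

  blockTotals≡ : ∀ x j b → blockTotals x j b ≡ ∑ (upTo (b * L)) (λ i → count (positions n (j * L + i)) x)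
  blockTotals≡ x j zero    = refl
  blockTotals≡ x j (suc b) = sym (trans (∑-upTo-+ L (b * L) _) (cong (total L (marked x j) +_)
    (trans (∑-cong (upTo (b * L)) (λ i → cong (λ i → count (positions n i) x) (shift (j * L) L i))) (sym (blockTotals≡ x (suc j) b)))))
    where
    shift : ∀ m l i → m + (l + i) ≡ l + m + i
    shift = solve-∀

  blockTotals-ones : ∀ x → blockTotals x 0 β ≡ ones x
  blockTotals-ones x = trans (blockTotals≡ x 0 β) (∑-positions (β * L) n≤ x)

  tests-sound : ∀ {b} x j (G : Vec Guess b) → All (Holds {x = x}) (tests j G) → blockTotals x j b ≡ claimed G
  tests-sound x j []      holds = refl
  tests-sound x j (g ∷ G) holds = cong₂ _+_ (blockTests-sound x j g (All.++⁻ˡ (blockTests j g) holds))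
    (tests-sound x (suc j) G (All.++⁻ʳ (blockTests j g) holds))

  tests-complete : ∀ x j b → Σ (Vec Guess b) λ G → All (_∈ guesses) (toList G) × All (Holds {x = x}) (tests j G)
  tests-complete x j zero    = [] , [] , []
  tests-complete x j (suc b) =
    let g , g∈ , hg = blockTests-complete x j
        G , G∈ , hG = tests-complete x (suc j) b
    in g ∷ G , g∈ ∷ G∈ , All.++⁺ hg hG

  symmetric-comp : ∀ (φ : ℕ → Bool) → Comp W (suc (suc (suc (suc t) * 2))) (λ x → φ (ones x))
  symmetric-comp φ = comp-cong (λ x → true⇔⇒≡ (sound x) (complete x))
    (comp-node disj len (All.map⁺ (All.universal (λ G →
      comp-node conj (≤-trans (≤-reflexive (length-tests 0 G)) tests≤) (tests-comp 0 G)) accepted)))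
    where
    accepts? = λ (G : Vec Guess β) → T? (φ (claimed G))
    -- φ is evaluated while the formula is built: only guesses whose claimed total it accepts become
    -- disjuncts.
    accepted = filter accepts? (vecs guesses β)
    len : length (map (λ G → product (tests 0 G)) accepted) ≤ W
    len = begin
      length (map (λ G → product (tests 0 G)) accepted) ≡⟨ length-map _ accepted ⟩
      length accepted                       ≤⟨ length-filter accepts? (vecs guesses β) ⟩
      length (vecs guesses β)               ≡⟨ length-vecs guesses β ⟩
      length guesses ^ β                    ≡⟨ cong (_^ β) length-guesses ⟩
      (suc L * (L ^ suc κ) ^ r) ^ β         ≤⟨ guesses≤ ⟩
      W                                     ∎
      where open ≤-Reasoning
    sound : ∀ x → or (map (λ G → product (tests 0 G)) accepted at x) ≡ true → φ (ones x) ≡ true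
    sound x eq with find (Any.map⁻ (or-true⁻ (map (λ G → product (tests 0 G)) accepted) eq))
    ... | G , G∈ , holds = trans (cong φ (trans (sym (blockTotals-ones x)) (tests-sound x 0 G (and-true⁻ (tests 0 G) holds))))
      (Equivalence.to T-≡ (proj₂ (∈-filter⁻ accepts? {xs = vecs guesses β} G∈)))
    complete : ∀ x → φ (ones x) ≡ true → or (map (λ G → product (tests 0 G)) accepted at x) ≡ true
    complete x eq = let G , G∈ , holds = tests-complete x 0 β in or-true⁺ {gs = map (λ G → product (tests 0 G)) accepted} (Any.map⁺ (lose
      (∈-filter⁺ accepts? (vecs-∈ G G∈) (Equivalence.from T-≡
        -- The honest guess passes its tests, so soundness identifies its claimed total with the
        -- number of ones.
        (trans (cong φ (trans (sym (tests-sound x 0 G holds)) (blockTotals-ones x))) eq)))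
      (and-true⁺ holds)))

-- Estimates by powers of two

n<2^n : ∀ n → n < 2 ^ n
n<2^n zero    = s≤s z≤n
n<2^n (suc n) = subst (suc (suc n) ≤_) (cong (2 ^ n +_) (sym (+-identityʳ (2 ^ n))))
  (+-mono-≤ (m^n>0 2 n) (n<2^n n))

floor-power : ∀ b → 2 ≤ b → ∀ n → 1 ≤ n → ∃ λ e → b ^ e ≤ n × n < b ^ suc e
floor-power b 2≤b 1 _ = 0 , ≤-refl , subst (1 <_) (sym (*-identityʳ b)) 2≤b
floor-power b 2≤b (suc n@(suc _)) _ with floor-power b 2≤b n (s≤s z≤n)
... | e , lower , upper with b ^ suc e ≤? suc n
... | yes le = suc e , le , ≤-<-trans upper (m<n*m′ (b ^ suc e) {{>-nonZero (≤-<-trans z≤n upper)}})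
  where
  m<n*m′ : ∀ m .{{_ : NonZero m}} → m < b * m
  m<n*m′ m = <-≤-trans (m<m*n m 2 ≤-refl) (≤-trans (*-monoʳ-≤ m 2≤b) (≤-reflexive (*-comm m b)))
... | no gt  = e , m≤n⇒m≤1+n lower , ≰⇒> gt

+-2^ : ∀ {a b} u → a ≤ 2 ^ u → b ≤ 2 ^ u → a + b ≤ 2 ^ suc u
+-2^ u a≤ b≤ = ≤-trans (+-mono-≤ a≤ b≤) (≤-reflexive (cong (2 ^ u +_) (sym (+-identityʳ (2 ^ u)))))

*-2^ : ∀ {a b} u v → a ≤ 2 ^ u → b ≤ 2 ^ v → a * b ≤ 2 ^ (u + v)
*-2^ u v a≤ b≤ = ≤-trans (*-mono-≤ a≤ b≤) (≤-reflexive (sym (^-distribˡ-+-* 2 u v)))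

^-2^ : ∀ {a} u m → a ≤ 2 ^ u → a ^ m ≤ 2 ^ (u * m)
^-2^ u m a≤ = ≤-trans (^-monoˡ-≤ m a≤) (≤-reflexive (^-*-assoc 2 u m))

≤-literal : ∀ a b → T (a ≤ᵇ b) → a ≤ b
≤-literal a b = ≤ᵇ⇒≤ a b

-- Choice of parameters: 2 ^ e blocks of length L = 2 ^ x with 2 ^ (e + x) > n, samples of size
-- 2 ^ κ = K σ², and prime powers ≥ 2 ^ g.  The size is 2 ^ O(z⁴ 2 ^ e) with z = e (13 + 13 i) ≈ log n.

-- They are variables with defining equations because concrete powers of 2 would be unfolded.

module Parameters
  (i e z x l κ₁ κ₂ r a₃ a₇ : ℕ)
  (1≤e : 1 ≤ e) (z≡ : z ≡ e * (13 + 13 * i)) (x≡ : x ≡ e * (12 + 13 * i))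
  -- K = 16 · 4^l is at least 16 z² and so exceeds r, which is at most 12 z². The 1 in κ₂ doubles σ,
  -- to match the 2 in 2L ≤ σ · `modulus`. The value of r is the least with L^(κ+1) < 2^r.
  (κ₁≡ : κ₁ ≡ 4 + 2 * l) (κ₂≡ : κ₂ ≡ 1 + e * (3 + 4 * i)) (r≡ : r ≡ suc (x * suc (κ₁ + (κ₂ + κ₂))))
  where

  κ g t K σ L V : ℕ
  κ = κ₁ + (κ₂ + κ₂)
  -- The excess over e pays in `M<` for the factor K of the sample size, for the square of the
  -- doubled σ, and for strictness.
  g = e + (κ₁ + 3)
  -- With j = i + 1, blocks are counted with `suc (suc t)` = 3j levels, that is in 6j layers.
  t = suc (3 * i)
  K = 2 ^ κ₁
  σ = 2 ^ κ₂
  L = 2 ^ x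
  V = 2 ^ e

  module _ (z≤2^l : z ≤ 2 ^ l) (2^l≤2z : 2 ^ l ≤ 2 * z)
           (3^≥ : 2 ^ g ≤ 3 ^ a₃) (3^≤ : 3 ^ a₃ ≤ 3 * 2 ^ g)
           (7^≥ : 2 ^ g ≤ 7 ^ a₇) (7^≤ : 7 ^ a₇ ≤ 7 * 2 ^ g) where

    open Exponents g a₃ a₇ public

    x≤z : x ≤ z
    x≤z = subst₂ _≤_ (sym x≡) (sym z≡) (*-monoʳ-≤ e (n≤1+n _))

    e≤z : e ≤ z
    e≤z = subst (e ≤_) (sym z≡) (m≤m*n e (13 + 13 * i))

    1≤z : 1 ≤ z
    1≤z = ≤-trans 1≤e e≤z

    instance
      z≢0 : NonZero z
      z≢0 = >-nonZero 1≤z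

    κ₂≤z : κ₂ ≤ z
    κ₂≤z = subst₂ _≤_ (sym κ₂≡) (sym z≡) (begin
      1 + e * (3 + 4 * i)                        ≤⟨ +-monoˡ-≤ _ 1≤e ⟩
      e + e * (3 + 4 * i)                        ≤⟨ m≤m+n _ (e * (9 + 9 * i)) ⟩
      e + e * (3 + 4 * i) + e * (9 + 9 * i)      ≡⟨ join e i ⟩
      e * (13 + 13 * i)                          ∎)
      where
      open ≤-Reasoning
      join : ∀ e i → e + e * (3 + 4 * i) + e * (9 + 9 * i) ≡ e * (13 + 13 * i)
      join = solve-∀

    T≤z : suc (suc t) ≤ z
    T≤z = subst (suc (suc t) ≤_) (sym z≡) (begin
      3 + 3 * i              ≤⟨ +-mono-≤ (≤-literal 3 13 _) (*-monoˡ-≤ i (≤-literal 3 13 _)) ⟩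
      13 + 13 * i            ≤⟨ m≤n*m (13 + 13 * i) e {{>-nonZero 1≤e}} ⟩
      e * (13 + 13 * i)      ∎)
      where open ≤-Reasoning

    l≤2z : l ≤ 2 * z
    l≤2z = ≤-trans (<⇒≤ (n<2^n l)) 2^l≤2z

    κ≤11z : suc κ ≤ 11 * z
    κ≤11z = begin
      suc κ                               ≡⟨ trans (cong (λ k → suc (k + (κ₂ + κ₂))) κ₁≡) (split l κ₂) ⟩
      5 + (2 * l + 2 * κ₂)                ≤⟨ +-mono-≤ (*-monoʳ-≤ 5 1≤z) (+-mono-≤ (*-monoʳ-≤ 2 l≤2z) (*-monoʳ-≤ 2 κ₂≤z)) ⟩
      5 * z + (2 * (2 * z) + 2 * z)       ≡⟨ join z ⟩
      11 * z                              ∎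
      where
      open ≤-Reasoning
      split : ∀ l k → suc (4 + 2 * l + (k + k)) ≡ 5 + (2 * l + 2 * k)
      split = solve-∀
      join : ∀ z → 5 * z + (2 * (2 * z) + 2 * z) ≡ 11 * z
      join = solve-∀

    r≤12z² : r ≤ 12 * (z * z)
    r≤12z² = begin
      r                          ≡⟨ r≡ ⟩
      1 + x * suc κ              ≤⟨ +-mono-≤ (*-mono-≤ 1≤z 1≤z) (*-mono-≤ x≤z κ≤11z) ⟩
      z * z + z * (11 * z)       ≡⟨ join z ⟩
      12 * (z * z)               ∎
      where
      open ≤-Reasoning
      join : ∀ z → z * z + z * (11 * z) ≡ 12 * (z * z)
      join = solve-∀

    K≡ : K ≡ 16 * (2 ^ l * 2 ^ l)
    K≡ = trans (cong (2 ^_) κ₁≡) (trans (^-distribˡ-+-* 2 4 (2 * l)) (cong (16 *_) (trans (cong (2 ^_) (cong (l +_) (+-identityʳ l))) (^-distribˡ-+-* 2 l l))))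

    r<K : r < K
    r<K = begin-strict
      r                       ≤⟨ r≤12z² ⟩
      12 * (z * z)            <⟨ *-monoˡ-< (z * z) {{m*n≢0 z z}} (≤-literal 13 16 _) ⟩
      16 * (z * z)            ≤⟨ *-monoʳ-≤ 16 (*-mono-≤ z≤2^l z≤2^l) ⟩
      16 * (2 ^ l * 2 ^ l)    ≡⟨ sym K≡ ⟩
      K                       ∎
      where open ≤-Reasoning

    K≤64z² : K ≤ 64 * (z * z)
    K≤64z² = begin
      K                          ≡⟨ K≡ ⟩
      16 * (2 ^ l * 2 ^ l)       ≤⟨ *-monoʳ-≤ 16 (*-mono-≤ 2^l≤2z 2^l≤2z) ⟩
      16 * (2 * z * (2 * z))     ≡⟨ join z ⟩
      64 * (z * z)               ∎
      where
      open ≤-Reasoning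
      join : ∀ z → 16 * (2 * z * (2 * z)) ≡ 64 * (z * z)
      join = solve-∀

    2≤K : 2 ≤ K
    2≤K = ≤-trans (s≤s (subst (1 ≤_) (sym r≡) (s≤s z≤n))) r<K

    2^κ≡Kσ² : 2 ^ κ ≡ K * (σ * σ)
    2^κ≡Kσ² = trans (^-distribˡ-+-* 2 κ₁ (κ₂ + κ₂)) (cong (K *_) (^-distribˡ-+-* 2 κ₂ κ₂))

    L^sucκ : L ^ suc κ ≡ 2 ^ (x * suc κ)
    L^sucκ = ^-*-assoc 2 x (suc κ)

    enough : L ^ suc κ < 2 ^ r
    enough = subst (_< 2 ^ r) (sym L^sucκ) (^-monoʳ-< 2 ≤-refl (≤-reflexive (sym r≡)))

    2^≤modulus : ∀ T → 2 ^ (g * T + g * T + g * T) ≤ modulus T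
    2^≤modulus T = begin
      2 ^ (g * T + g * T + g * T)                 ≡⟨ trans (^-distribˡ-+-* 2 (g * T + g * T) (g * T))
                                                       (cong (_* 2 ^ (g * T)) (^-distribˡ-+-* 2 (g * T) (g * T))) ⟩
      2 ^ (g * T) * 2 ^ (g * T) * 2 ^ (g * T)     ≤⟨ *-mono-≤ (*-monoʳ-≤ (2 ^ (g * T)) (raise 3 a₃ 3^≥)) (raise 7 a₇ 7^≥) ⟩
      modulus T                                   ∎
      where
      open ≤-Reasoning
      raise : ∀ p a → 2 ^ g ≤ p ^ a → 2 ^ (g * T) ≤ p ^ (a * T)
      raise p a le = subst₂ _≤_ (^-*-assoc 2 g T) (^-*-assoc p a T) (^-monoˡ-≤ T le)

    -- The multiples of e compare as 6 + 8i with 6 + 9i, so at i = 0 nothing is left to spare except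
    -- through the excess of g over e.
    M< : 2 ^ κ < modulus (suc t)
    M< = <-≤-trans (^-monoʳ-< 2 ≤-refl (subst (_≤ g * s + g * s + g * s) (cong (λ k → suc (κ₁ + (k + k))) (sym κ₂≡))
           (≤-trans (m≤m+n _ _) (≤-reflexive (sym (split e κ₁ i)))))) (2^≤modulus s)
      where
      s = suc t
      split : ∀ e k i → (e + (k + 3)) * (2 + 3 * i) + (e + (k + 3)) * (2 + 3 * i) + (e + (k + 3)) * (2 + 3 * i)
              ≡ suc (k + (1 + e * (3 + 4 * i) + (1 + e * (3 + 4 * i)))) + (15 + 5 * k + e * i + 9 * k * i + 27 * i)
      split = solve-∀

    -- Here the exponents add up exactly: 3 + 4i from σ and 9 + 9i from the modulus give the 12 +
    -- 13i of the block length.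
    L< : 2 * L ≤ σ * modulus (suc (suc t))
    L< = begin
      2 ^ suc x                                    ≤⟨ ^-monoʳ-≤ 2 (subst₂ (λ a k → suc a ≤ k + (g * s + g * s + g * s)) (sym x≡) (sym κ₂≡)
                                                        (≤-trans (m≤m+n _ _) (≤-reflexive (sym (split e κ₁ i))))) ⟩
      2 ^ (κ₂ + (g * s + g * s + g * s))           ≡⟨ ^-distribˡ-+-* 2 κ₂ (g * s + g * s + g * s) ⟩
      σ * 2 ^ (g * s + g * s + g * s)              ≤⟨ *-monoʳ-≤ σ (2^≤modulus s) ⟩
      σ * modulus s                                ∎
      where
      open ≤-Reasoning
      s = suc (suc t)
      split : ∀ e k i → 1 + e * (3 + 4 * i) + ((e + (k + 3)) * (3 + 3 * i) + (e + (k + 3)) * (3 + 3 * i) + (e + (k + 3)) * (3 + 3 * i))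
              ≡ suc (e * (12 + 13 * i)) + (9 * k + 9 * k * i + 27 + 27 * i)
      split = solve-∀

    n≤ : ∀ {n} → n < 2 ^ z → n ≤ V * L
    n≤ n< = ≤-trans (<⇒≤ n<) (≤-reflexive (trans (cong (2 ^_) z≡e+x) (^-distribˡ-+-* 2 e x)))
      where
      split : ∀ e i → e * (13 + 13 * i) ≡ e + e * (12 + 13 * i)
      split = solve-∀
      z≡e+x : z ≡ e + x
      z≡e+x = trans z≡ (trans (split e i) (cong (e +_) (sym x≡)))

    -- 131072 = 2^17 dominates the constants below, the largest being 30 · 7 · 64 · 8 = 107520 from
    -- the fan-in of the counting levels.
    module Size (c : ℕ) (c≥ : 131072 ≤ c) where

      y w : ℕ
      -- The order of the bit length of a guess: 2^e blocks, each with r = O(z²) translates made of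
      -- O(z) residues of O(z) bits.
      y = z * z * z * z * V
      w = c * y

      z²≤y : z * z ≤ y
      z²≤y = ≤-trans (≤-trans (m≤m*n (z * z) z) (m≤m*n (z * z * z) z)) (m≤m*n (z * z * z * z) V {{m^n≢0 2 e}})

      z≤y : z ≤ y
      z≤y = ≤-trans (m≤m*n z z) z²≤y

      fits : ∀ a b → T (a ≤ᵇ 131072) → b ≤ y → a * b ≤ w
      fits a b a≤ b≤ = *-mono-≤ (≤-trans (≤-literal a 131072 a≤) c≥) b≤

      ≤2^w : ∀ {a b} → a ≤ 2 ^ b → b ≤ w → a ≤ 2 ^ w
      ≤2^w a≤ b≤ = ≤-trans a≤ (^-monoʳ-≤ 2 b≤)

      N : ℕ
      N = L + 2 ^ κ

      instance
        N≢0 : NonZero N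
        N≢0 = >-nonZero (≤-trans (m^n>0 2 x) (m≤m+n L (2 ^ κ)))

      N≤ : N ≤ 2 ^ suc (11 * z)
      N≤ = +-2^ (11 * z) (^-monoʳ-≤ 2 (≤-trans x≤z (m≤n*m z 11))) (^-monoʳ-≤ 2 (<⇒≤ κ≤11z))

      -- The factor (N p²)^m dominates, with exponent O(z) · m. Here m is O(K 2^e) = O(z² 2^e),
      -- because the powers of 2, 3 and 7 overshoot 2^g by a factor of 7 at most.
      affordable : ∀ p q m → 1 ≤ m → p ≤ 7 → q ≤ 21 → m ≤ 7 * 2 ^ g → Affordable (2 ^ w) N p q m
      affordable p q m 1≤m p≤ q≤ m≤ = ≤2^w size≤ exponent≤ , ≤2^w width≤ (≤-trans suc-m≤ exponent≤)
        where
        open ≤-Reasoning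
        p²≤ : p * p ≤ 2 ^ 6
        p²≤ = ≤-trans (*-mono-≤ p≤ p≤) (≤-literal 49 64 _)
        E = (suc (11 * z) + 6) * m
        1≤E+6 : 3 ≤ E + 6
        1≤E+6 = ≤-trans (≤-literal 3 6 _) (m≤n+m 6 E)
        size≤ : q * ((N * (p * p)) ^ m * (p * p) + p) ≤ 2 ^ (5 + suc (E + 6))
        size≤ = *-2^ 5 (suc (E + 6)) (≤-trans q≤ (≤-literal 21 32 _))
          (+-2^ (E + 6) (*-2^ E 6 (^-2^ (suc (11 * z) + 6) m (*-2^ (suc (11 * z)) 6 N≤ p²≤)) p²≤)
            (≤-trans (≤-trans p≤ (≤-literal 7 8 _)) (^-monoʳ-≤ 2 1≤E+6)))
        m≤E : m ≤ E
        m≤E = m≤n*m m (suc (11 * z) + 6)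
        suc-m≤ : suc m ≤ 5 + suc (E + 6)
        suc-m≤ = ≤-trans (s≤s (≤-trans m≤E (m≤m+n E 6))) (m≤n+m (suc (E + 6)) 5)
        width≤ : m * 2 + 1 ≤ 2 ^ suc m
        width≤ = begin
          m * 2 + 1      ≤⟨ m≤m+n (m * 2 + 1) 1 ⟩
          m * 2 + 1 + 1  ≡⟨ double m ⟩
          2 * suc m      ≤⟨ *-monoʳ-≤ 2 (n<2^n m) ⟩
          2 ^ suc m      ∎
          where
          double : ∀ m → m * 2 + 1 + 1 ≡ 2 * suc m
          double = solve-∀
        m≤z²V : m ≤ (7 * 64 * 8) * (z * z * V)
        m≤z²V = begin
          m                                ≤⟨ m≤ ⟩
          7 * 2 ^ g                        ≡⟨ cong (7 *_) (trans (^-distribˡ-+-* 2 e (κ₁ + 3)) (cong (V *_) (^-distribˡ-+-* 2 κ₁ 3))) ⟩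
          7 * (V * (K * 8))                ≤⟨ *-monoʳ-≤ 7 (*-monoʳ-≤ V (*-monoˡ-≤ 8 K≤64z²)) ⟩
          7 * (V * (64 * (z * z) * 8))     ≡⟨ regroup 7 64 8 (z * z) V ⟩
          (7 * 64 * 8) * (z * z * V)               ∎
          where
          regroup : ∀ a b c y v → a * (v * (b * y * c)) ≡ a * b * c * (y * v)
          regroup = solve-∀
        exponent≤ : 5 + suc (E + 6) ≤ w
        exponent≤ = begin
          5 + suc (E + 6)                        ≡⟨ gather z m ⟩
          (7 + 11 * z) * m + 12                  ≤⟨ +-mono-≤ (*-monoˡ-≤ m (+-monoˡ-≤ (11 * z) (*-monoʳ-≤ 7 1≤z)))
                                                             (*-monoʳ-≤ 12 (*-mono-≤ 1≤z 1≤m)) ⟩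
          (7 * z + 11 * z) * m + 12 * (z * m)    ≡⟨ join z m ⟩
          30 * (z * m)                           ≤⟨ *-monoʳ-≤ 30 (*-monoʳ-≤ z m≤z²V) ⟩
          30 * (z * ((7 * 64 * 8) * (z * z * V)))        ≡⟨ regroup 30 (7 * 64 * 8) z V ⟩
          (30 * (7 * 64 * 8)) * (z * z * z * V)               ≤⟨ fits (30 * (7 * 64 * 8)) (z * z * z * V) _ (*-monoˡ-≤ V (m≤m*n (z * z * z) z)) ⟩
          w                                      ∎
          where
          gather : ∀ z m → 5 + suc ((suc (11 * z) + 6) * m + 6) ≡ (7 + 11 * z) * m + 12
          gather = solve-∀
          join : ∀ z m → (7 * z + 11 * z) * m + 12 * (z * m) ≡ 30 * (z * m)
          join = solve-∀
          regroup : ∀ a b z v → a * (z * (b * (z * z * v))) ≡ a * b * (z * z * z * v)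
          regroup = solve-∀

      sample≤ : r * suc (2 ^ κ) ≤ 2 ^ w
      sample≤ = ≤2^w (*-2^ κ₁ (suc κ) (<⇒≤ r<K) (+-2^ {1} κ (m^n>0 2 κ) ≤-refl)) (begin
        κ₁ + suc κ        ≤⟨ +-mono-≤ (≤-trans (m≤m+n κ₁ _) (<⇒≤ κ≤11z)) κ≤11z ⟩
        11 * z + 11 * z   ≡⟨ join z ⟩
        22 * z            ≤⟨ fits 22 z _ z≤y ⟩
        w                 ∎)
        where
        open ≤-Reasoning
        join : ∀ z → 11 * z + 11 * z ≡ 22 * z
        join = solve-∀

      checkCount≤ : ∀ T → T ≤ z → checkCount T ≤ 2 ^ (20 * (z * z))
      checkCount≤ T T≤z = ≤-trans (+-2^ (suc (18 * (z * z))) (≤-trans (power 2 g (m≤n*m (2 ^ g) 7)) (^-monoʳ-≤ 2 (n≤1+n (18 * (z * z)))))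
          (+-2^ (18 * (z * z)) (power 3 a₃ (≤-trans 3^≤ (*-monoˡ-≤ (2 ^ g) (≤-literal 3 7 _)))) (power 7 a₇ 7^≤)))
          (^-monoʳ-≤ 2 (≤-trans (+-monoˡ-≤ (18 * (z * z)) (*-monoʳ-≤ 2 (*-mono-≤ 1≤z 1≤z))) (≤-reflexive (join (z * z)))))
        where
        open ≤-Reasoning
        join : ∀ y → 2 * y + 18 * y ≡ 20 * y
        join = solve-∀
        g≤ : 3 + g ≤ 18 * z
        g≤ = begin
          3 + g                     ≡⟨ split e κ₁ ⟩
          e + (κ₁ + 6)              ≤⟨ +-mono-≤ e≤z (+-mono-≤ (≤-trans (m≤m+n κ₁ _) (<⇒≤ κ≤11z)) (*-monoʳ-≤ 6 1≤z)) ⟩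
          z + (11 * z + 6 * z)      ≡⟨ merge z ⟩
          18 * z                    ∎
          where
          split : ∀ e k → 3 + (e + (k + 3)) ≡ e + (k + 6)
          split = solve-∀
          merge : ∀ z → z + (11 * z + 6 * z) ≡ 18 * z
          merge = solve-∀
        power : ∀ p a → p ^ a ≤ 7 * 2 ^ g → p ^ (a * T) ≤ 2 ^ (18 * (z * z))
        power p a le = begin
          p ^ (a * T)         ≡⟨ sym (^-*-assoc p a T) ⟩
          (p ^ a) ^ T         ≤⟨ ^-2^ (3 + g) T (≤-trans le (*-2^ 3 g (≤-literal 7 8 _) ≤-refl)) ⟩
          2 ^ ((3 + g) * T)   ≤⟨ ^-monoʳ-≤ 2 (≤-trans (*-mono-≤ g≤ T≤z) (≤-reflexive (*-assoc 18 z z))) ⟩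
          2 ^ (18 * (z * z))  ∎

      check≤ : checkCount (suc t) ≤ 2 ^ w
      check≤ = ≤2^w (checkCount≤ (suc t) (<⇒≤ T≤z)) (fits 20 (z * z) _ z²≤y)

      x*sucκ≤ : x * suc κ ≤ 11 * (z * z)
      x*sucκ≤ = ≤-trans (*-mono-≤ x≤z κ≤11z) (≤-reflexive (swap z))
        where
        swap : ∀ z → z * (11 * z) ≡ 11 * (z * z)
        swap = solve-∀

      tests≤ : V * (checkCount (suc (suc t)) + L ^ suc κ) ≤ 2 ^ w
      tests≤ = ≤2^w (*-2^ e (suc (20 * (z * z))) ≤-refl (+-2^ (20 * (z * z)) (checkCount≤ (suc (suc t)) T≤z)
          (≤-trans (≤-reflexive L^sucκ) (^-monoʳ-≤ 2 (≤-trans x*sucκ≤ (*-monoˡ-≤ (z * z) (≤-literal 11 20 _))))))) (begin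
        e + suc (20 * (z * z))             ≤⟨ +-mono-≤ (≤-trans e≤z (m≤m*n z z)) (+-monoˡ-≤ (20 * (z * z)) (*-mono-≤ 1≤z 1≤z)) ⟩
        z * z + (z * z + 20 * (z * z))     ≡⟨ join (z * z) ⟩
        22 * (z * z)                       ≤⟨ fits 22 (z * z) _ z²≤y ⟩
        w                                  ∎)
        where
        open ≤-Reasoning
        join : ∀ y → y + (y + 20 * y) ≡ 22 * y
        join = solve-∀

      guesses≤ : (suc L * (L ^ suc κ) ^ r) ^ V ≤ 2 ^ w
      guesses≤ = ≤2^w (^-2^ (suc x + x * suc κ * r) V (*-2^ (suc x) (x * suc κ * r) (+-2^ {1} x (m^n>0 2 x) ≤-refl)
          (^-2^ (x * suc κ) r (≤-reflexive L^sucκ)))) (begin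
        (suc x + x * suc κ * r) * V                                ≤⟨ *-monoˡ-≤ V (+-mono-≤ (+-mono-≤ 1≤z x≤z) (*-mono-≤ x*sucκ≤ r≤12z²)) ⟩
        (z + z + 11 * (z * z) * (12 * (z * z))) * V                ≤⟨ *-monoˡ-≤ V (+-monoˡ-≤ _ (+-mono-≤ z≤z⁴ z≤z⁴)) ⟩
        (z * z * z * z + z * z * z * z + 11 * (z * z) * (12 * (z * z))) * V  ≡⟨ join z V ⟩
        134 * y                                                    ≤⟨ fits 134 y _ ≤-refl ⟩
        w                                                          ∎)
        where
        open ≤-Reasoning
        z≤z⁴ : z ≤ z * z * z * z
        z≤z⁴ = ≤-trans (m≤m*n z z) (≤-trans (m≤m*n (z * z) z) (m≤m*n (z * z * z) z))
        join : ∀ z v → (z * z * z * z + z * z * z * z + 11 * (z * z) * (12 * (z * z))) * v ≡ 134 * (z * z * z * z * v)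
        join = solve-∀

      symmetric-comp : ∀ {n} → n < 2 ^ z → (φ : ℕ → Bool) →
        Comp {n} (2 ^ w) (suc (suc (suc (suc t) * 2))) (λ x → φ (ones x))
      symmetric-comp n< = Construction.symmetric-comp g a₃ a₇ t
        (affordable 2 21 (2 ^ g) (m^n>0 2 g) (≤-literal 2 7 _) ≤-refl (m≤n*m (2 ^ g) 7))
        (affordable 3 14 (3 ^ a₃) (m^n>0 3 a₃) (≤-literal 3 7 _) (≤-literal 14 21 _) (≤-trans 3^≤ (*-monoˡ-≤ (2 ^ g) (≤-literal 3 7 _))))
        (affordable 7 6 (7 ^ a₇) (m^n>0 7 a₇) ≤-refl (≤-literal 6 21 _) 7^≤)
        V L κ K σ r {{m^n≢0 2 x}} {{m^n≢0 2 κ₁}} {{m^n≢0 2 κ₂}}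
        (n≤ n<) (m≤m+n L (2 ^ κ)) (m≤n+m (2 ^ κ) L) 2^κ≡Kσ² 2≤K r<K enough M< L<
        sample≤ check≤ tests≤ guesses≤

-- From fan-in to circuit size

power-above : ∀ p → 2 ≤ p → ∀ m → 1 ≤ m → ∃ λ a → m ≤ p ^ a × p ^ a ≤ p * m
power-above p 2≤p m 1≤m = let e , lower , upper = floor-power p 2≤p m 1≤m in suc e , <⇒≤ upper , *-monoʳ-≤ p lower

log-size : ∀ {s} d w .{{_ : NonZero d}} .{{_ : NonZero w}} → s ≤ d + suc (2 ^ w) ^ d → ⌊log₂ s ⌋ ≤ 3 * d * w
log-size {s} d w s≤ = begin
  ⌊log₂ s ⌋                        ≤⟨ ⌊log₂⌋-mono-≤ (≤-trans s≤ (+-2^ (suc w * d) d≤ (^-2^ (suc w) d (+-2^ {1} w (m^n>0 2 w) ≤-refl)))) ⟩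
  ⌊log₂ 2 ^ suc (suc w * d) ⌋      ≡⟨ ⌊log₂[2^n]⌋≡n (suc (suc w * d)) ⟩
  1 + (d + w * d)                  ≤⟨ +-mono-≤ (*-mono-≤ (>-nonZero⁻¹ d) (>-nonZero⁻¹ w)) (+-monoˡ-≤ (w * d) (m≤m*n d w)) ⟩
  d * w + (d * w + w * d)          ≡⟨ join d w ⟩
  3 * d * w                        ∎
  where
  open ≤-Reasoning
  d≤ : d ≤ 2 ^ (suc w * d)
  d≤ = ≤-trans (<⇒≤ (n<2^n d)) (^-monoʳ-≤ 2 (m≤m+n d (w * d)))
  join : ∀ d w → d * w + (d * w + w * d) ≡ 3 * d * w
  join = solve-∀

-- Since 2 ^ (D e) ≤ 2 ^ D n, raising 2 ^ e to the power 6 D gives O(n⁶).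
power-size : ∀ A D e′ n ℓ → D * e′ ≤ ℓ → 1 ≤ ℓ → (2 ^ D) ^ e′ ≤ n →
  let z = suc e′ * D in
  (A * (z * z * z * z * 2 ^ suc e′)) ^ (D * 6) ≤
  A ^ (D * 6) * (suc D * suc D * suc D * suc D) ^ (D * 6) * (2 ^ D) ^ 6 * ℓ ^ (4 * (D * 6)) * n ^ 6
power-size A D e′ n ℓ De′≤ℓ 1≤ℓ below = begin
  (A * (z * z * z * z * 2 ^ suc e′)) ^ F
    ≡⟨ trans (^-distribʳ-* F A _) (cong (A ^ F *_) (^-distribʳ-* F (z * z * z * z) (2 ^ suc e′))) ⟩
  A ^ F * ((z * z * z * z) ^ F * (2 ^ suc e′) ^ F)
    ≤⟨ *-monoʳ-≤ (A ^ F) (*-mono-≤ z-part e-part) ⟩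
  A ^ F * (Q ^ F * ℓ ^ (4 * F) * ((2 ^ D) ^ 6 * n ^ 6))
    ≡⟨ regroup (A ^ F) (Q ^ F) (ℓ ^ (4 * F)) ((2 ^ D) ^ 6) (n ^ 6) ⟩
  A ^ F * Q ^ F * (2 ^ D) ^ 6 * ℓ ^ (4 * F) * n ^ 6 ∎
  where
  open ≤-Reasoning
  z = suc e′ * D
  F = D * 6
  Q = suc D * suc D * suc D * suc D
  regroup : ∀ a q l p m → a * (q * l * (p * m)) ≡ a * q * p * l * m
  regroup = solve-∀
  z≤ : z ≤ suc D * ℓ
  z≤ = begin
    D + e′ * D       ≡⟨ cong (D +_) (*-comm e′ D) ⟩
    D + D * e′       ≤⟨ +-mono-≤ (m≤m*n D ℓ {{>-nonZero 1≤ℓ}}) De′≤ℓ ⟩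
    D * ℓ + ℓ        ≡⟨ +-comm (D * ℓ) ℓ ⟩
    suc D * ℓ        ∎
  z-part : (z * z * z * z) ^ F ≤ Q ^ F * ℓ ^ (4 * F)
  z-part = begin
    (z * z * z * z) ^ F    ≤⟨ ^-monoˡ-≤ F (*-mono-≤ (*-mono-≤ (*-mono-≤ z≤ z≤) z≤) z≤) ⟩
    (suc D * ℓ * (suc D * ℓ) * (suc D * ℓ) * (suc D * ℓ)) ^ F ≡⟨ cong (_^ F) (fourth (suc D) ℓ) ⟩
    (Q * ℓ ^ 4) ^ F        ≡⟨ ^-distribʳ-* F Q (ℓ ^ 4) ⟩
    Q ^ F * (ℓ ^ 4) ^ F    ≡⟨ cong (Q ^ F *_) (^-*-assoc ℓ 4 F) ⟩
    Q ^ F * ℓ ^ (4 * F)    ∎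
    where
    fourth : ∀ q ℓ → q * ℓ * (q * ℓ) * (q * ℓ) * (q * ℓ) ≡ q * q * q * q * (ℓ * (ℓ * (ℓ * (ℓ * 1))))
    fourth = solve-∀
  e-part : (2 ^ suc e′) ^ F ≤ (2 ^ D) ^ 6 * n ^ 6
  e-part = begin
    (2 ^ suc e′) ^ F              ≡⟨ sym (^-*-assoc (2 ^ suc e′) D 6) ⟩
    ((2 ^ suc e′) ^ D) ^ 6        ≡⟨ cong (_^ 6) (trans (^-*-assoc 2 (suc e′) D) (trans (cong (2 ^_) (*-comm (suc e′) D)) (sym (^-*-assoc 2 D (suc e′))))) ⟩
    (2 ^ D * (2 ^ D) ^ e′) ^ 6    ≤⟨ ^-monoˡ-≤ 6 (*-monoʳ-≤ (2 ^ D) below) ⟩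
    (2 ^ D * n) ^ 6               ≡⟨ ^-distribʳ-* 6 (2 ^ D) n ⟩
    (2 ^ D) ^ 6 * n ^ 6           ∎

-- A canonical input for each number of ones turns a symmetric f into a function of `ones`.
withOnes : ∀ n → ℕ → Vec Bool n
withOnes zero    c       = []
withOnes (suc n) zero    = false ∷ withOnes n zero
withOnes (suc n) (suc c) = true ∷ withOnes n c

ones-withOnes : ∀ {n} (x : Vec Bool n) → ones (withOnes n (ones x)) ≡ ones x
ones-withOnes x = ones-at _ _ (ones≤ x)
  where
  ones≤ : ∀ {n} (x : Vec Bool n) → ones x ≤ n
  ones≤ []          = z≤n
  ones≤ (true  ∷ x) = s≤s (ones≤ x)
  ones≤ (false ∷ x) = m≤n⇒m≤1+n (ones≤ x)
  ones-at : ∀ n c → c ≤ n → ones (withOnes n c) ≡ c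
  ones-at zero    zero    _       = refl
  ones-at (suc n) zero    _       = ones-at n zero z≤n
  ones-at (suc n) (suc c) (s≤s l) = cong suc (ones-at n c l)

Realizable : ℕ → Set
Realizable d = Σ ℕ λ C → Σ ℕ λ k → Σ ℕ λ N →
  (n : ℕ) → N ≤ n → (f : Vec Bool n → Bool) → Symmetric f →
    Σ ℕ λ s → Σ (Circuit n (suc s)) λ c →
      Computes c f × depth c ≡ d ×
      ⌊log₂ (suc s) ⌋ ^ (13 * (d ∸ 2)) ≤ C * ⌈log₂ n ⌉ ^ k * n ^ 6

symmetric-comp : ∀ i e z x l κ₁ κ₂ r → 1 ≤ e → z ≡ e * (13 + 13 * i) → x ≡ e * (12 + 13 * i) →
  κ₁ ≡ 4 + 2 * l → κ₂ ≡ 1 + e * (3 + 4 * i) → r ≡ suc (x * suc (κ₁ + (κ₂ + κ₂))) → z ≤ 2 ^ l → 2 ^ l ≤ 2 * z →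
  ∀ c → 131072 ≤ c → ∀ {n} → n < 2 ^ z → (φ : ℕ → Bool) →
  Comp {n} (2 ^ (c * (z * z * z * z * 2 ^ e))) (suc (suc (suc (suc (suc (3 * i))) * 2))) (λ x → φ (ones x))
symmetric-comp i e z x l κ₁ κ₂ r 1≤e z≡ x≡ κ₁≡ κ₂≡ r≡ z≤ ≤2z c c≥ n< φ =
  let a₃ , 3≥ , 3≤ = power-above 3 (s≤s (s≤s z≤n)) (2 ^ (e + (κ₁ + 3))) (m^n>0 2 (e + (κ₁ + 3)))
      a₇ , 7≥ , 7≤ = power-above 7 (s≤s (s≤s z≤n)) (2 ^ (e + (κ₁ + 3))) (m^n>0 2 (e + (κ₁ + 3)))
  in Parameters.Size.symmetric-comp i e z x l κ₁ κ₂ r a₃ a₇ 1≤e z≡ x≡ κ₁≡ κ₂≡ r≡ z≤ ≤2z 3≥ 3≤ 7≥ 7≤ c c≥ n< φ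

comp⇒circuit : ∀ {n W h} {g : Fn n} → Comp W (suc h) g →
  (Small : ℕ → Set) → (∀ {s} → suc s ≤ suc h + suc W ^ suc h → Small s) →
  Σ ℕ λ s → Σ (Circuit n (suc s)) λ C → Computes C g × depth C ≡ suc h × Small s
comp⇒circuit (comp φ φ≡g b) Small small with bounded⇒circuit b
... | s , C , computes , depth≡ , s≤ = s , C , (λ x → trans (computes x) (φ≡g x)) , depth≡ , small s≤

module Realize (c : ℕ) (c≥ : 131072 ≤ c) (i D k : ℕ) (D≡ : D ≡ 13 + 13 * i) (k≡ : k ≡ suc (suc (suc (3 * i))) * 2) where

  d F P Q : ℕ
  d = suc (suc k)
  F = D * 6
  P = 3 * d * c
  Q = suc D * suc D * suc D * suc D

  exponent : 13 * k ≡ F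
  exponent = trans (cong (13 *_) k≡) (trans (rearrange i) (cong (_* 6) (sym D≡)))
    where
    rearrange : ∀ i → 13 * ((3 + 3 * i) * 2) ≡ (13 + 13 * i) * 6
    rearrange = solve-∀

  1≤D : 1 ≤ D
  1≤D = subst (1 ≤_) (sym D≡) (s≤s z≤n)

  module _ {n : ℕ} (2≤n : 2 ≤ n) (f : Vec Bool n → Bool) (sym-f : Symmetric f) where

    ℓ : ℕ
    ℓ = ⌈log₂ n ⌉

    f-comp : ∀ e z → 1 ≤ e → z ≡ e * D → n < 2 ^ z → Comp (2 ^ (c * (z * z * z * z * 2 ^ e))) d f
    f-comp e z 1≤e z≡ n< =
      let l , z≤ , ≤2z = power-above 2 ≤-refl z (subst (1 ≤_) (sym z≡) (*-mono-≤ 1≤e 1≤D))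
      in comp-cong (λ x → sym-f (withOnes n (ones x)) x (ones-withOnes x))
           (subst (λ h → Comp (2 ^ (c * (z * z * z * z * 2 ^ e))) (suc (suc h)) (λ x → f (withOnes n (ones x)))) (sym k≡)
           (symmetric-comp i e z _ l _ _ _ 1≤e (trans z≡ (cong (e *_) D≡)) refl refl refl refl z≤ ≤2z c c≥ n<
             (λ m → f (withOnes n m))))

    size : ∀ e′ z {s} → z ≡ suc e′ * D → 1 ≤ z → (2 ^ D) ^ e′ ≤ n →
           suc s ≤ d + suc (2 ^ (c * (z * z * z * z * 2 ^ suc e′))) ^ d →
           ⌊log₂ (suc s) ⌋ ^ (13 * k) ≤ P ^ F * Q ^ F * (2 ^ D) ^ 6 * ℓ ^ (4 * F) * n ^ 6
    size e′ z {s} refl 1≤z lower s≤ = begin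
      ⌊log₂ (suc s) ⌋ ^ (13 * k)                      ≡⟨ cong (⌊log₂ (suc s) ⌋ ^_) exponent ⟩
      ⌊log₂ (suc s) ⌋ ^ F                             ≤⟨ ^-monoˡ-≤ F (log-size d w {{_}} {{w≢0}} s≤) ⟩
      (3 * d * w) ^ F                                 ≡⟨ cong (_^ F) (sym (*-assoc (3 * d) c _)) ⟩
      (P * (z * z * z * z * 2 ^ suc e′)) ^ F          ≤⟨ power-size P D e′ n ℓ De′≤ℓ (⌈log₂⌉-mono-≤ 2≤n) lower ⟩
      P ^ F * Q ^ F * (2 ^ D) ^ 6 * ℓ ^ (4 * F) * n ^ 6 ∎
      where
      open ≤-Reasoning
      w : ℕ
      w = c * (z * z * z * z * 2 ^ suc e′)
      w≢0 : NonZero w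
      w≢0 = >-nonZero (*-mono-≤ (≤-trans (≤-literal 1 131072 _) c≥)
        (*-mono-≤ (*-mono-≤ (*-mono-≤ (*-mono-≤ 1≤z 1≤z) 1≤z) 1≤z) (m^n>0 2 (suc e′))))
      De′≤ℓ : D * e′ ≤ ℓ
      De′≤ℓ = subst (_≤ ℓ) (⌈log₂2^n⌉≡n (D * e′)) (⌈log₂⌉-mono-≤ (subst (_≤ n) (^-*-assoc 2 D e′) lower))

    Small : ℕ → Set
    Small s = ⌊log₂ (suc s) ⌋ ^ (13 * k) ≤ P ^ F * Q ^ F * (2 ^ D) ^ 6 * ℓ ^ (4 * F) * n ^ 6

    circuit : Σ ℕ λ s → Σ (Circuit n (suc s)) λ C → Computes C f × depth C ≡ d × Small s
    -- The least e with n < 2^(D e), so that 2^e is at most 2 n^(1/D).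
    circuit = from-power (floor-power (2 ^ D) (^-monoʳ-≤ 2 1≤D) n (≤-trans (s≤s z≤n) 2≤n))
      where
      from-power : (∃ λ e′ → (2 ^ D) ^ e′ ≤ n × n < (2 ^ D) ^ suc e′) →
                   Σ ℕ λ s → Σ (Circuit n (suc s)) λ C → Computes C f × depth C ≡ d × Small s
      from-power (e′ , lower , upper) = comp⇒circuit
        (f-comp (suc e′) (suc e′ * D) (s≤s z≤n) refl
          (subst (n <_) (trans (^-*-assoc 2 D (suc e′)) (cong (2 ^_) (*-comm D (suc e′)))) upper))
        Small (size e′ (suc e′ * D) refl (≤-trans 1≤D (m≤m+n D (e′ * D))) lower)

  realizable : Realizable d
  -- The threshold 2 keeps `⌈log₂ n ⌉` positive, so that it can absorb constants.
  realizable = P ^ F * Q ^ F * (2 ^ D) ^ 6 , 4 * F , 2 , λ n 2≤n f sym-f → circuit 2≤n f sym-f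

theorem4p1 : (d : ℕ) → 8 ≤ d → d % 6 ≡ 2 →
    Σ ℕ λ C → Σ ℕ λ k → Σ ℕ λ N →
    (n : ℕ) → N ≤ n → (f : Vec Bool n → Bool) → Symmetric f →
    Σ ℕ λ s → Σ (Circuit n (suc s)) λ c →
    Computes c f × depth c ≡ d ×
    ⌊log₂ (suc s) ⌋ ^ (13 * (d ∸ 2)) ≤ C * ⌈log₂ n ⌉ ^ k * n ^ 6
theorem4p1 d 8≤d d%6≡2 = subst Realizable (shape (d / 6) (trans (m≡m%n+[m/n]*n d 6) (cong (_+ d / 6 * 6) d%6≡2)))
                                -- The index is i = j - 1, which builds j ≥ 1 into all exponents;
                                -- `8 ≤ d` excludes j = 0.
                                (Realize.realizable 131072 ≤-refl (pred (d / 6)) _ _ refl refl)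
  where
  shape : ∀ j → d ≡ 2 + j * 6 → suc (suc (suc (suc (suc (3 * pred j))) * 2)) ≡ d
  shape zero    d≡ = contradiction 8≤d (<⇒≱ (subst (_< 8) (sym d≡) (≤-literal 3 8 _)))
  shape (suc i) d≡ = trans (rearrange i) (sym d≡)
    where
    rearrange : ∀ i → 2 + (3 + 3 * i) * 2 ≡ 2 + (1 + i) * 6
    rearrange = solve-∀
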